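{- There exists an absolute constant $\varepsilon > 0$ such that for all positive integers $k$ and $\ell$ satisfying $0 < \ell < \binom{k}{2}$ we have $$\mathrm{ind}(k,\ell) < 1 - \varepsilon.$$
   Context: All graphs are finite and simple. For a positive integer $k$ and a graph $G$ with at least $k$ vertices, let $A = A_{G,k}$ be chosen uniformly at random from all $k$-element subsets of $V(G)$, and let $X_{G,k} = e(G[A])$ be the number of edges of $G$ with both endpoints in $A$. For integers $n \ge k$ and $0 \le \ell \le \binom{k}{2}$ let $I(n,k,\ell) = \max\{\mathbb{P}(X_{G,k} = \ell) : G \text{ is a graph on } n \text{ vertices}\}$. For fixed $k,\ell$ the sequence $I(n,k,\ell)$ is non-increasing in $n$, and the edge-inducibility is defined by $\mathrm{ind}(k,\ell) := \lim_{n\to\infty} I(n,k,\ell)$. -}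

module Defs where

open import Data.Bool.Base using (Bool; true; false; if_then_else_; T)
open import Data.Bool.Properties using (T?)
open import Data.Fin.Base as Fin using (Fin; zero; suc; punchIn; inject₁; pinch)
import Data.Fin.Properties as Fin
open import Data.Fin.Subset using (Subset; inside; outside; _∈_; ∣_∣)
open import Data.Fin.Subset.Properties using (_∈?_)
open import Data.Integer.Base as ℤ using (+_)
import Data.Integer.Properties as ℤ
open import Data.List.Base as List
  using (List; []; _∷_; _++_; length; filter; map; allFin; cartesianProduct; cartesianProductWith)
open import Data.List.Membership.Propositional using () renaming (_∈_ to _∈ˡ_)
open import Data.List.Membership.Propositional.Properties
  using (∈-map⁺; ∈-map⁻; ∈-cartesianProductWith⁺)
import Data.List.Properties as List
import Data.List.Relation.Unary.All as All
open import Data.List.Relation.Unary.Any using (here; there)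
open import Data.Nat.Base as ℕ using (ℕ; zero; suc; z≤n; s≤s)
import Data.Nat.Properties as ℕ
import Data.Nat.Tactic.RingSolver as ℕ-Ring
open import Data.Product using (∃-syntax; _×_; _,_; proj₁; proj₂)
open import Data.Rational as ℚ using (ℚ; 0ℚ; 1ℚ; ½)
import Data.Rational.Properties as ℚ
open import Data.Rational.Solver using (module +-*-Solver)
import Data.Rational.Unnormalised.Base as ℚᵘ
import Data.Rational.Unnormalised.Properties as ℚᵘ
open import Data.Sum.Base using (_⊎_; inj₁; inj₂)
open import Data.Vec.Base as Vec using (Vec; []; _∷_; lookup; insertAt; tabulate)
import Data.Vec.Properties as Vec
open import Function.Base using (_∘_; id)
open import Relation.Binary.Bundles using (DecTotalOrder)
open import Relation.Binary.Definitions using (tri<; tri≈; tri>)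
open import Relation.Binary.PropositionalEquality
open import Relation.Nullary using (¬_; Dec; yes; no; does; contradiction)
open import Relation.Nullary.Decidable using (_×-dec_)
open import Data.List.Extrema (DecTotalOrder.totalOrder ℚ.≤-decTotalOrder) using (max; argmax-sel; xs≤max)
open import Algebra.Properties.Semiring.Sum ℕ.+-*-semiring
  using (sum; sum-cong-≗; sum-remove; sum-replicate-zero; ∑-distrib-+; *-distribˡ-sum)

record Graph (n : ℕ) : Set where
  field
    adj        : Fin n → Fin n → Bool
    adj-sym    : ∀ i j → adj i j ≡ adj j i
    adj-irrefl : ∀ i → adj i i ≡ false

open Graph public

-- Every edge with both endpoints in A is counted once, as the pair (i , j)
-- with i < j.
edge? : ∀ {n} (G : Graph n) (A : Subset n) (p : Fin n × Fin n) →
        Dec (proj₁ p Fin.< proj₂ p × proj₁ p ∈ A × proj₂ p ∈ A × T (adj G (proj₁ p) (proj₂ p)))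
edge? G A (i , j) = (i Fin.<? j) ×-dec (i ∈? A) ×-dec (j ∈? A) ×-dec T? (adj G i j)

e : ∀ {n} → Graph n → Subset n → ℕ
e {n} G A = length (filter (edge? G A) (cartesianProduct (allFin n) (allFin n)))

allVecs : ∀ {X : Set} → List X → ∀ n → List (Vec X n)
allVecs xs zero    = [] ∷ []
allVecs xs (suc n) = cartesianProductWith _∷_ xs (allVecs xs n)

allSubsets : ∀ n → List (Subset n)
allSubsets = allVecs (inside ∷ outside ∷ [])

kSubsets : ∀ n k → List (Subset n)
kSubsets n k = filter (λ A → ∣ A ∣ ℕ.≟ k) (allSubsets n)

-- The graph whose adjacency matrix agrees with M strictly above the diagonal.
fromMatrix : ∀ {n} → Vec (Vec Bool n) n → Graph n
fromMatrix {n} M = record { adj = a ; adj-sym = a-sym ; adj-irrefl = a-irr }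
  where
  a : Fin n → Fin n → Bool
  a i j with Fin.<-cmp i j
  ... | tri< _ _ _ = lookup (lookup M i) j
  ... | tri≈ _ _ _ = false
  ... | tri> _ _ _ = lookup (lookup M j) i

  a-sym : ∀ i j → a i j ≡ a j i
  a-sym i j with Fin.<-cmp i j | Fin.<-cmp j i
  ... | tri< _ _ _ | tri> _ _ _ = refl
  ... | tri≈ _ _ _ | tri≈ _ _ _ = refl
  ... | tri> _ _ _ | tri< _ _ _ = refl
  ... | tri< p _ _ | tri< _ _ q = contradiction p q
  ... | tri< p _ _ | tri≈ _ _ q = contradiction p q
  ... | tri≈ _ p _ | tri< _ q _ = contradiction (sym p) q
  ... | tri≈ _ p _ | tri> _ q _ = contradiction (sym p) q
  ... | tri> _ _ p | tri≈ q _ _ = contradiction p q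
  ... | tri> _ _ p | tri> q _ _ = contradiction p q

  a-irr : ∀ i → a i i ≡ false
  a-irr i with Fin.<-cmp i i
  ... | tri< _ p _ = contradiction refl p
  ... | tri≈ _ _ _ = refl
  ... | tri> _ p _ = contradiction refl p

allGraphs : ∀ n → List (Graph n)
allGraphs n = map fromMatrix (allVecs (allVecs (true ∷ false ∷ []) n) n)

allVecs-complete : ∀ {X : Set} {xs : List X} → (∀ x → x ∈ˡ xs) →
                   ∀ {n} (v : Vec X n) → v ∈ˡ allVecs xs n
allVecs-complete c []      = here refl
allVecs-complete c (x ∷ v) = ∈-cartesianProductWith⁺ _∷_ (c x) (allVecs-complete c v)

-- Every graph occurs in allGraphs, up to pointwise equality of adjacency.
allGraphs-complete : ∀ {n} (G : Graph n) →
                     ∃[ H ] H ∈ˡ allGraphs n × (∀ i j → adj H i j ≡ adj G i j)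
allGraphs-complete {n} G =
  fromMatrix M , ∈-map⁺ fromMatrix (allVecs-complete (allVecs-complete c) M) , agree
  where
  M : Vec (Vec Bool n) n
  M = tabulate (λ i → tabulate (adj G i))

  c : ∀ b → b ∈ˡ true ∷ false ∷ []
  c true  = here refl
  c false = there (here refl)

  M-lookup : ∀ i j → lookup (lookup M i) j ≡ adj G i j
  M-lookup i j = trans (cong (λ r → lookup r j) (Vec.lookup∘tabulate _ i))
                       (Vec.lookup∘tabulate _ j)

  agree : ∀ i j → adj (fromMatrix M) i j ≡ adj G i j
  agree i j with Fin.<-cmp i j
  ... | tri< _ _ _    = M-lookup i j
  ... | tri≈ _ refl _ = sym (adj-irrefl G i)
  ... | tri> _ _ _    = trans (M-lookup j i) (adj-sym G j i)

𝟙 : ∀ {P : Set} → Dec P → ℕ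
𝟙 d = if does d then 1 else 0

𝟙-cong : ∀ {P Q : Set} (p : Dec P) (q : Dec Q) → (P → Q) → (Q → P) → 𝟙 p ≡ 𝟙 q
𝟙-cong (yes _) (yes _) _ _ = refl
𝟙-cong (no _)  (no _)  _ _ = refl
𝟙-cong (yes a) (no b)  f _ = contradiction (f a) b
𝟙-cong (no a)  (yes b) _ g = contradiction (g b) a

𝟙-no : ∀ {P : Set} (p : Dec P) → ¬ P → 𝟙 p ≡ 0
𝟙-no (yes a) b = contradiction a b
𝟙-no (no _)  _ = refl

𝟙-≡ : ∀ {a b} (d : Dec (a ≡ b)) x → a ℕ.* (𝟙 d ℕ.* x) ≡ b ℕ.* (𝟙 d ℕ.* x)
𝟙-≡ (yes refl) x = refl
𝟙-≡ {a} {b} (no _) x = trans (ℕ.*-zeroʳ a) (sym (ℕ.*-zeroʳ b))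

sumˡ : ∀ {X : Set} → (X → ℕ) → List X → ℕ
sumˡ f []       = 0
sumˡ f (x ∷ xs) = f x ℕ.+ sumˡ f xs

sumˡ-++ : ∀ {X : Set} (f : X → ℕ) xs ys → sumˡ f (xs ++ ys) ≡ sumˡ f xs ℕ.+ sumˡ f ys
sumˡ-++ f []       ys = refl
sumˡ-++ f (x ∷ xs) ys =
  trans (cong (f x ℕ.+_) (sumˡ-++ f xs ys)) (sym (ℕ.+-assoc (f x) _ _))

sumˡ-map : ∀ {X Y : Set} (f : Y → ℕ) (g : X → Y) xs → sumˡ f (map g xs) ≡ sumˡ (f ∘ g) xs
sumˡ-map f g []       = refl
sumˡ-map f g (x ∷ xs) = cong (f (g x) ℕ.+_) (sumˡ-map f g xs)

sumˡ-tabulate : ∀ {X : Set} (f : X → ℕ) {n} (g : Fin n → X) →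
                sumˡ f (List.tabulate g) ≡ sum (f ∘ g)
sumˡ-tabulate f {zero}  g = refl
sumˡ-tabulate f {suc n} g = cong (f (g zero) ℕ.+_) (sumˡ-tabulate f (g ∘ suc))

sumˡ-× : ∀ {X Y : Set} (f : X × Y → ℕ) xs ys →
         sumˡ f (cartesianProduct xs ys) ≡ sumˡ (λ x → sumˡ (λ y → f (x , y)) ys) xs
sumˡ-× f []       ys = refl
sumˡ-× f (x ∷ xs) ys = trans (sumˡ-++ f (map (x ,_) ys) _)
  (cong₂ ℕ._+_ (sumˡ-map f (x ,_) ys) (sumˡ-× f xs ys))

length-filter : ∀ {X : Set} {P : X → Set} (P? : ∀ x → Dec (P x)) xs →
                length (filter P? xs) ≡ sumˡ (λ x → 𝟙 (P? x)) xs
length-filter P? []       = refl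
length-filter P? (x ∷ xs) with does (P? x)
... | true  = cong suc (length-filter P? xs)
... | false = length-filter P? xs

sumˡ-filter : ∀ {X : Set} {P : X → Set} (P? : ∀ x → Dec (P x)) (f : X → ℕ) xs →
              sumˡ f (filter P? xs) ≡ sumˡ (λ x → 𝟙 (P? x) ℕ.* f x) xs
sumˡ-filter P? f []       = refl
sumˡ-filter P? f (x ∷ xs) with does (P? x)
... | true  = cong₂ ℕ._+_ (sym (ℕ.+-identityʳ (f x))) (sumˡ-filter P? f xs)
... | false = sumˡ-filter P? f xs

sumˢ : ∀ {n} → (Subset n → ℕ) → ℕ
sumˢ {zero}  F = F []
sumˢ {suc n} F = sumˢ (F ∘ (inside ∷_)) ℕ.+ sumˢ (F ∘ (outside ∷_))

sumˢ-list : ∀ {n} (F : Subset n → ℕ) → sumˡ F (allSubsets n) ≡ sumˢ F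
sumˢ-list {zero}  F = ℕ.+-identityʳ (F [])
sumˢ-list {suc n} F =
  trans (sumˡ-++ F (map (inside ∷_) S) _) (cong₂ ℕ._+_ (half inside)
    (trans (sumˡ-++ F (map (outside ∷_) S) []) (trans (ℕ.+-identityʳ _) (half outside))))
  where
  S = allSubsets n
  half : ∀ b → sumˡ F (map (b ∷_) S) ≡ sumˢ (F ∘ (b ∷_))
  half b = trans (sumˡ-map F (b ∷_) S) (sumˢ-list (F ∘ (b ∷_)))

sumˢ-cong : ∀ {n} {F H : Subset n → ℕ} → (∀ A → F A ≡ H A) → sumˢ F ≡ sumˢ H
sumˢ-cong {zero}  h = h []
sumˢ-cong {suc n} h = cong₂ ℕ._+_ (sumˢ-cong (λ A → h (inside ∷ A))) (sumˢ-cong (λ A → h (outside ∷ A)))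

sumˢ-mono : ∀ {n} {F H : Subset n → ℕ} → (∀ A → F A ℕ.≤ H A) → sumˢ F ℕ.≤ sumˢ H
sumˢ-mono {zero}  h = h []
sumˢ-mono {suc n} h = ℕ.+-mono-≤ (sumˢ-mono (λ A → h (inside ∷ A))) (sumˢ-mono (λ A → h (outside ∷ A)))

sumˢ-+ : ∀ {n} (F H : Subset n → ℕ) → sumˢ (λ A → F A ℕ.+ H A) ≡ sumˢ F ℕ.+ sumˢ H
sumˢ-+ {zero}  F H = refl
sumˢ-+ {suc n} F H = trans
  (cong₂ ℕ._+_ (sumˢ-+ (F ∘ (inside ∷_)) (H ∘ (inside ∷_)))
               (sumˢ-+ (F ∘ (outside ∷_)) (H ∘ (outside ∷_))))
  (+-swap (sumˢ (F ∘ (inside ∷_))) (sumˢ (H ∘ (inside ∷_))) _ _)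
  where
  +-swap : ∀ a b c d → (a ℕ.+ b) ℕ.+ (c ℕ.+ d) ≡ (a ℕ.+ c) ℕ.+ (b ℕ.+ d)
  +-swap = ℕ-Ring.solve-∀

sumˢ-* : ∀ {n} c (F : Subset n → ℕ) → sumˢ (λ A → c ℕ.* F A) ≡ c ℕ.* sumˢ F
sumˢ-* {zero}  c F = refl
sumˢ-* {suc n} c F = trans (cong₂ ℕ._+_ (sumˢ-* c (F ∘ (inside ∷_))) (sumˢ-* c (F ∘ (outside ∷_))))
  (sym (ℕ.*-distribˡ-+ c (sumˢ (F ∘ (inside ∷_))) _))

sumˢ-sum : ∀ {m n} (F : Fin m → Subset n → ℕ) →
           sum (λ v → sumˢ (F v)) ≡ sumˢ (λ A → sum (λ v → F v A))
sumˢ-sum {n = zero}  F = refl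
sumˢ-sum {n = suc n} F = trans (∑-distrib-+ (λ v → sumˢ (F v ∘ (inside ∷_))) _)
  (cong₂ ℕ._+_ (sumˢ-sum (λ v → F v ∘ (inside ∷_))) (sumˢ-sum (λ v → F v ∘ (outside ∷_))))

notIn : ∀ {n} → Fin n → Subset n → ℕ
notIn v A = if lookup A v then 0 else 1

without : ∀ {n} → Fin (suc n) → Subset n → Subset (suc n)
without v B = insertAt B v outside

∣without∣ : ∀ {n} (v : Fin (suc n)) (B : Subset n) → ∣ without v B ∣ ≡ ∣ B ∣
∣without∣ zero    B             = refl
∣without∣ (suc v) (inside ∷ B)  = cong suc (∣without∣ v B)
∣without∣ (suc v) (outside ∷ B) = ∣without∣ v B

sumˢ-without : ∀ {n} (v : Fin (suc n)) (F : Subset (suc n) → ℕ) →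
               sumˢ (λ B → F (without v B)) ≡ sumˢ (λ A → notIn v A ℕ.* F A)
sumˢ-without zero F = sym (cong₂ ℕ._+_
  (sumˢ-* 0 (F ∘ (inside ∷_)))
  (sumˢ-cong (λ A → ℕ.+-identityʳ (F (outside ∷ A)))))
sumˢ-without {suc n} (suc v) F = cong₂ ℕ._+_
  (sumˢ-without v (F ∘ (inside ∷_))) (sumˢ-without v (F ∘ (outside ∷_)))

sum-notIn : ∀ {n} (A : Subset n) → sum (λ v → notIn v A) ℕ.+ ∣ A ∣ ≡ n
sum-notIn []            = refl
sum-notIn (inside ∷ A)  = trans (ℕ.+-suc _ _) (cong suc (sum-notIn A))
sum-notIn (outside ∷ A) = cong suc (sum-notIn A)

sum-zero : ∀ {n} {f : Fin n → ℕ} → (∀ i → f i ≡ 0) → sum f ≡ 0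
sum-zero {n} h = trans (sum-cong-≗ h) (sum-replicate-zero n)

e-sum : ∀ {n} (G : Graph n) (A : Subset n) →
        e G A ≡ sum (λ i → sum (λ j → 𝟙 (edge? G A (i , j))))
e-sum {n} G A = trans (length-filter (edge? G A) (cartesianProduct (allFin n) (allFin n)))
  (trans (sumˡ-× (λ p → 𝟙 (edge? G A p)) (allFin n) (allFin n))
  (trans (sumˡ-tabulate (λ i → sumˡ (λ j → 𝟙 (edge? G A (i , j))) (allFin n)) id)
         (sum-cong-≗ (λ i → sumˡ-tabulate (λ j → 𝟙 (edge? G A (i , j))) id))))

e-cong : ∀ {n} (G H : Graph n) → (∀ i j → adj H i j ≡ adj G i j) → ∀ A → e H A ≡ e G A
e-cong {n} G H h A = trans (e-sum H A) (trans
  (sum-cong-≗ (λ i → sum-cong-≗ (λ j → 𝟙-cong (edge? H A (i , j)) (edge? G A (i , j))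
    (λ (a , b , c , d) → a , b , c , subst T (h i j) d)
    (λ (a , b , c , d) → a , b , c , subst T (sym (h i j)) d))))
  (sym (e-sum G A)))

punchIn-mono-< : ∀ {n} (v : Fin (suc n)) {i j : Fin n} → i Fin.< j → punchIn v i Fin.< punchIn v j
punchIn-mono-< zero                          p       = s≤s p
punchIn-mono-< (suc v) {zero}  {suc j} p       = s≤s z≤n
punchIn-mono-< (suc v) {suc i} {suc j} (s≤s p) = s≤s (punchIn-mono-< v p)

punchIn-cancel-< : ∀ {n} (v : Fin (suc n)) {i j : Fin n} → punchIn v i Fin.< punchIn v j → i Fin.< j
punchIn-cancel-< zero                    (s≤s p) = p
punchIn-cancel-< (suc v) {zero}  {suc j} p       = s≤s z≤n
punchIn-cancel-< (suc v) {suc i} {suc j} (s≤s p) = s≤s (punchIn-cancel-< v p)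

e-without : ∀ {n} (H : Graph (suc n)) (G : Graph n) (v : Fin (suc n)) →
            (∀ i j → adj H (punchIn v i) (punchIn v j) ≡ adj G i j) →
            ∀ B → e H (without v B) ≡ e G B
e-without {n} H G v h B = trans (e-sum H A) (trans
  (trans (sum-remove {i = v} (λ i → sum (row i)))
    (cong₂ ℕ._+_ (sum-zero (λ j → 𝟙-no (edge? H A (v , j)) (λ (_ , b , _) → v∉A b)))
      (sum-cong-≗ (λ i → trans (sum-remove {i = v} (row (punchIn v i)))
        (cong₂ ℕ._+_ (𝟙-no (edge? H A (punchIn v i , v)) (λ (_ , _ , c , _) → v∉A c))
          (sum-cong-≗ (λ j → 𝟙-cong (edge? H A (punchIn v i , punchIn v j)) (edge? G B (i , j))
            (λ (a , b , c , d) → punchIn-cancel-< v a , from b , from c , subst T (h i j) d)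
            (λ (a , b , c , d) → punchIn-mono-< v a , to b , to c , subst T (sym (h i j)) d))))))))
  (sym (e-sum G B)))
  where
  A = without v B

  row : Fin (suc n) → Fin (suc n) → ℕ
  row i j = 𝟙 (edge? H A (i , j))

  v∉A : ¬ (v ∈ A)
  v∉A p with trans (sym (Vec.insertAt-lookup B v outside)) (Vec.[]=⇒lookup p)
  ... | ()

  from : ∀ {i} → punchIn v i ∈ A → i ∈ B
  from {i} p = Vec.lookup⇒[]= i B
    (trans (sym (Vec.insertAt-punchIn B v outside i)) (Vec.[]=⇒lookup p))

  to : ∀ {i} → i ∈ B → punchIn v i ∈ A
  to {i} p = Vec.lookup⇒[]= (punchIn v i) A
    (trans (Vec.insertAt-punchIn B v outside i) (Vec.[]=⇒lookup p))

delete : ∀ {n} → Graph (suc n) → Fin (suc n) → Graph n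
delete G v = record
  { adj        = λ i j → adj G (punchIn v i) (punchIn v j)
  ; adj-sym    = λ i j → adj-sym G (punchIn v i) (punchIn v j)
  ; adj-irrefl = λ i → adj-irrefl G (punchIn v i)
  }

-- The vertices inject₁ v and suc v of the new graph are non-adjacent copies of v.
duplicate : ∀ {n} → Graph n → Fin n → Graph (suc n)
duplicate G v = record
  { adj        = λ i j → adj G (pinch v i) (pinch v j)
  ; adj-sym    = λ i j → adj-sym G (pinch v i) (pinch v j)
  ; adj-irrefl = λ i → adj-irrefl G (pinch v i)
  }

pinch-punchIn-inject₁ : ∀ {n} (v i : Fin n) → pinch v (punchIn (inject₁ v) i) ≡ i
pinch-punchIn-inject₁ zero    i       = refl
pinch-punchIn-inject₁ (suc v) zero    = refl
pinch-punchIn-inject₁ (suc v) (suc i) = cong suc (pinch-punchIn-inject₁ v i)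

pinch-punchIn-suc : ∀ {n} (v i : Fin n) → pinch v (punchIn (suc v) i) ≡ i
pinch-punchIn-suc zero    zero    = refl
pinch-punchIn-suc zero    (suc i) = refl
pinch-punchIn-suc (suc v) zero    = refl
pinch-punchIn-suc (suc v) (suc i) = cong suc (pinch-punchIn-suc v i)

notIn-suc-without : ∀ {n} (v : Fin n) (B : Subset n) → notIn (suc v) (without (inject₁ v) B) ≡ notIn v B
notIn-suc-without zero    (b ∷ B) = refl
notIn-suc-without (suc v) (b ∷ B) = notIn-suc-without v B

good : ∀ {n} → Graph n → ℕ → ℕ → ℕ
good {n} G k ℓ = length (filter (λ A → e G A ℕ.≟ ℓ) (kSubsets n k))

#kSubsets : ℕ → ℕ → ℕ
#kSubsets n k = length (kSubsets n k)

weight : ∀ {n} → ℕ → (Subset n → ℕ) → Subset n → ℕ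
weight k F A = 𝟙 (∣ A ∣ ℕ.≟ k) ℕ.* F A

hit : ∀ {n} → Graph n → ℕ → Subset n → ℕ
hit G ℓ A = 𝟙 (e G A ℕ.≟ ℓ)

good-sum : ∀ {n} (G : Graph n) k ℓ → good G k ℓ ≡ sumˢ (weight k (hit G ℓ))
good-sum {n} G k ℓ = trans (length-filter (λ A → e G A ℕ.≟ ℓ) (kSubsets n k))
  (trans (sumˡ-filter (λ A → ∣ A ∣ ℕ.≟ k) (hit G ℓ) (allSubsets n)) (sumˢ-list (weight k (hit G ℓ))))

#kSubsets-sum : ∀ n k → #kSubsets n k ≡ sumˢ {n} (λ A → 𝟙 (∣ A ∣ ℕ.≟ k))
#kSubsets-sum n k = trans (length-filter (λ A → ∣ A ∣ ℕ.≟ k) (allSubsets n))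
  (sumˢ-list {n} (λ A → 𝟙 (∣ A ∣ ℕ.≟ k)))

#kSubsets-pos : ∀ {n k} → k ℕ.≤ n → ℕ.NonZero (#kSubsets n k)
#kSubsets-pos {n} {k} k≤n =
  ℕ.>-nonZero (subst (1 ℕ.≤_) (sym (#kSubsets-sum n k)) (go k≤n))
  where
  go : ∀ {n k} → k ℕ.≤ n → 1 ℕ.≤ sumˢ {n} (λ A → 𝟙 (∣ A ∣ ℕ.≟ k))
  go {zero}  {zero}  _       = s≤s z≤n
  go {suc n} {zero}  _       = ℕ.≤-trans (go {n} {0} z≤n) (ℕ.m≤n+m _ _)
  go {suc n} {suc k} (s≤s p) = ℕ.≤-trans (go p) (ℕ.m≤m+n _ _)

good≤ : ∀ {n} (G : Graph n) k ℓ → good G k ℓ ℕ.≤ #kSubsets n k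
good≤ {n} G k ℓ = List.length-filter (λ A → e G A ℕ.≟ ℓ) (kSubsets n k)

double-count : ∀ {n} k (F : Subset (suc n) → ℕ) →
  sum (λ v → sumˢ (weight k (F ∘ without v))) ℕ.+ k ℕ.* sumˢ (weight k F) ≡ suc n ℕ.* sumˢ (weight k F)
double-count {n} k F = begin
  sum (λ v → sumˢ (weight k (F ∘ without v))) ℕ.+ k ℕ.* S
    ≡⟨ cong (ℕ._+ k ℕ.* S) (sum-cong-≗ step) ⟩
  sum (λ v → sumˢ (λ A → notIn v A ℕ.* weight k F A)) ℕ.+ k ℕ.* S
    ≡⟨ cong₂ ℕ._+_ (sumˢ-sum (λ v A → notIn v A ℕ.* weight k F A)) (sym (sumˢ-* k (weight k F))) ⟩
  sumˢ (λ A → sum (λ v → notIn v A ℕ.* weight k F A)) ℕ.+ sumˢ (λ A → k ℕ.* weight k F A)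
    ≡⟨ sym (sumˢ-+ (λ A → sum (λ v → notIn v A ℕ.* weight k F A)) (λ A → k ℕ.* weight k F A)) ⟩
  sumˢ (λ A → sum (λ v → notIn v A ℕ.* weight k F A) ℕ.+ k ℕ.* weight k F A)
    ≡⟨ sumˢ-cong pointwise ⟩
  sumˢ (λ A → suc n ℕ.* weight k F A)
    ≡⟨ sumˢ-* (suc n) (weight k F) ⟩
  suc n ℕ.* S ∎
  where
  open ≡-Reasoning
  S = sumˢ (weight k F)

  step : ∀ v → sumˢ (weight k (F ∘ without v)) ≡ sumˢ (λ A → notIn v A ℕ.* weight k F A)
  step v = trans
    (sumˢ-cong (λ B → cong (λ c → 𝟙 (c ℕ.≟ k) ℕ.* F (without v B)) (sym (∣without∣ v B))))
    (sumˢ-without v (weight k F))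

  sum-*ʳ : ∀ {m} (f : Fin m → ℕ) x → sum (λ v → f v ℕ.* x) ≡ sum f ℕ.* x
  sum-*ʳ f x = trans (sum-cong-≗ (λ v → ℕ.*-comm (f v) x))
    (trans (sym (*-distribˡ-sum x f)) (ℕ.*-comm x (sum f)))

  pointwise : ∀ A → sum (λ v → notIn v A ℕ.* weight k F A) ℕ.+ k ℕ.* weight k F A
                    ≡ suc n ℕ.* weight k F A
  pointwise A = begin
    sum (λ v → notIn v A ℕ.* weight k F A) ℕ.+ k ℕ.* weight k F A
      ≡⟨ cong₂ ℕ._+_ (sum-*ʳ (λ v → notIn v A) (weight k F A))
                     (sym (𝟙-≡ (∣ A ∣ ℕ.≟ k) (F A))) ⟩
    sum (λ v → notIn v A) ℕ.* weight k F A ℕ.+ ∣ A ∣ ℕ.* weight k F A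
      ≡⟨ sym (ℕ.*-distribʳ-+ (weight k F A) (sum (λ v → notIn v A)) ∣ A ∣) ⟩
    (sum (λ v → notIn v A) ℕ.+ ∣ A ∣) ℕ.* weight k F A
      ≡⟨ cong (ℕ._* weight k F A) (sum-notIn A) ⟩
    suc n ℕ.* weight k F A ∎

good-delete : ∀ {n} (G : Graph (suc n)) k ℓ v →
              good (delete G v) k ℓ ≡ sumˢ (weight k (hit G ℓ ∘ without v))
good-delete G k ℓ v = trans (good-sum (delete G v) k ℓ)
  (sumˢ-cong (λ B → cong (λ c → 𝟙 (∣ B ∣ ℕ.≟ k) ℕ.* 𝟙 (c ℕ.≟ ℓ))
    (sym (e-without G (delete G v) v (λ _ _ → refl) B))))

sum-good-delete : ∀ {n} (G : Graph (suc n)) k ℓ →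
  sum (λ v → good (delete G v) k ℓ) ℕ.+ k ℕ.* good G k ℓ ≡ suc n ℕ.* good G k ℓ
sum-good-delete {n} G k ℓ = begin
  sum (λ v → good (delete G v) k ℓ) ℕ.+ k ℕ.* good G k ℓ
    ≡⟨ cong₂ ℕ._+_ (sum-cong-≗ (good-delete G k ℓ)) (cong (k ℕ.*_) (good-sum G k ℓ)) ⟩
  sum (λ v → sumˢ (weight k (hit G ℓ ∘ without v))) ℕ.+ k ℕ.* sumˢ (weight k (hit G ℓ))
    ≡⟨ double-count k (hit G ℓ) ⟩
  suc n ℕ.* sumˢ (weight k (hit G ℓ))
    ≡⟨ cong (suc n ℕ.*_) (sym (good-sum G k ℓ)) ⟩
  suc n ℕ.* good G k ℓ ∎
  where open ≡-Reasoning

sum-const : ∀ n c → sum {n} (λ _ → c) ≡ n ℕ.* c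
sum-const zero    c = refl
sum-const (suc n) c = cong (c ℕ.+_) (sum-const n c)

#kSubsets-suc : ∀ n k → suc n ℕ.* #kSubsets n k ℕ.+ k ℕ.* #kSubsets (suc n) k ≡ suc n ℕ.* #kSubsets (suc n) k
#kSubsets-suc n k = begin
  suc n ℕ.* #kSubsets n k ℕ.+ k ℕ.* #kSubsets (suc n) k
    ≡⟨ cong₂ ℕ._+_ (sym (sum-const (suc n) (#kSubsets n k))) (cong (k ℕ.*_) (one (suc n))) ⟩
  sum {suc n} (λ _ → #kSubsets n k) ℕ.+ k ℕ.* sumˢ {suc n} (weight k (λ _ → 1))
    ≡⟨ cong (ℕ._+ k ℕ.* sumˢ {suc n} (weight k (λ _ → 1))) (sum-cong-≗ {suc n} (λ _ → one n)) ⟩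
  sum {suc n} (λ _ → sumˢ {n} (weight k (λ _ → 1))) ℕ.+ k ℕ.* sumˢ {suc n} (weight k (λ _ → 1))
    ≡⟨ double-count {n} k (λ _ → 1) ⟩
  suc n ℕ.* sumˢ {suc n} (weight k (λ _ → 1))
    ≡⟨ cong (suc n ℕ.*_) (sym (one (suc n))) ⟩
  suc n ℕ.* #kSubsets (suc n) k ∎
  where
  open ≡-Reasoning
  one : ∀ m → #kSubsets m k ≡ sumˢ {m} (weight k (λ _ → 1))
  one m = trans (#kSubsets-sum m k) (sumˢ-cong {m} (λ A → sym (ℕ.*-identityʳ _)))

good-duplicate : ∀ {n} (G : Graph (suc n)) k ℓ v →
  good G k ℓ ℕ.+ good G k ℓ ℕ.≤ good (duplicate G v) k ℓ ℕ.+ good (delete G v) k ℓ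
good-duplicate {n} G k ℓ v = begin
  good G k ℓ ℕ.+ good G k ℓ
    ≡⟨ cong₂ ℕ._+_ (trans (good-sum G k ℓ) (miss p (pinch-punchIn-inject₁ v)))
                   (trans (good-sum G k ℓ) (miss q (pinch-punchIn-suc v))) ⟩
  sumˢ (λ A → notIn p A ℕ.* W A) ℕ.+ sumˢ (λ A → notIn q A ℕ.* W A)
    ≡⟨ sym (sumˢ-+ (λ A → notIn p A ℕ.* W A) (λ A → notIn q A ℕ.* W A)) ⟩
  sumˢ (λ A → notIn p A ℕ.* W A ℕ.+ notIn q A ℕ.* W A)
    ≤⟨ sumˢ-mono pointwise ⟩
  sumˢ (λ A → W A ℕ.+ notIn p A ℕ.* (notIn q A ℕ.* W A))
    ≡⟨ sumˢ-+ W (λ A → notIn p A ℕ.* (notIn q A ℕ.* W A)) ⟩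
  sumˢ W ℕ.+ sumˢ (λ A → notIn p A ℕ.* (notIn q A ℕ.* W A))
    ≡⟨ cong₂ ℕ._+_ (sym (good-sum D k ℓ)) both ⟩
  good D k ℓ ℕ.+ good (delete G v) k ℓ ∎
  where
  open ℕ.≤-Reasoning
  D = duplicate G v
  p = inject₁ v
  q = suc v
  W = weight k (hit D ℓ)

  restrict : ∀ u → (∀ i → pinch v (punchIn u i) ≡ i) → ∀ B → weight k (hit G ℓ) B ≡ W (without u B)
  restrict u h B = cong₂ (λ a b → 𝟙 (a ℕ.≟ k) ℕ.* 𝟙 (b ℕ.≟ ℓ)) (sym (∣without∣ u B))
    (sym (e-without D G u (λ i j → cong₂ (adj G) (h i) (h j)) B))

  miss : ∀ u → (∀ i → pinch v (punchIn u i) ≡ i) →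
         sumˢ (weight k (hit G ℓ)) ≡ sumˢ (λ A → notIn u A ℕ.* W A)
  miss u h = trans (sumˢ-cong (restrict u h)) (sumˢ-without u W)

  pointwise : ∀ A → notIn p A ℕ.* W A ℕ.+ notIn q A ℕ.* W A
                    ℕ.≤ W A ℕ.+ notIn p A ℕ.* (notIn q A ℕ.* W A)
  pointwise A with lookup A p | lookup A q
  ... | true  | true  = z≤n
  ... | true  | false = ℕ.≤-refl
  ... | false | true  = ℕ.≤-reflexive (ℕ.+-identityʳ _)
  ... | false | false = ℕ.≤-reflexive (1·x+1·x (W A))

    where
    1·x+1·x : ∀ x → 1 ℕ.* x ℕ.+ 1 ℕ.* x ≡ x ℕ.+ 1 ℕ.* (1 ℕ.* x)
    1·x+1·x = ℕ-Ring.solve-∀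

  both : sumˢ (λ A → notIn p A ℕ.* (notIn q A ℕ.* W A)) ≡ good (delete G v) k ℓ
  both = trans (sym (sumˢ-without p (λ A → notIn q A ℕ.* W A)))
    (trans (sumˢ-cong (λ B → cong₂ ℕ._*_ (notIn-suc-without v B)
             (sym (restrict p (pinch-punchIn-inject₁ v) B))))
    (trans (sym (sumˢ-without v (weight k (hit G ℓ))))
    (trans (sumˢ-cong (λ B → cong (λ c → 𝟙 (c ℕ.≟ k) ℕ.* hit G ℓ (without v B)) (∣without∣ v B)))
           (sym (good-delete G k ℓ v)))))

sum-≤ : ∀ {n} (f : Fin n → ℕ) c → (∀ i → f i ℕ.≤ c) → sum f ℕ.≤ n ℕ.* c
sum-≤ {zero}  f c h = z≤n
sum-≤ {suc n} f c h = ℕ.+-mono-≤ (h zero) (sum-≤ (f ∘ suc) c (h ∘ suc))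

sum-≥ : ∀ {n} (f : Fin n → ℕ) c → (∀ i → c ℕ.≤ f i) → n ℕ.* c ℕ.≤ sum f
sum-≥ {zero}  f c h = z≤n
sum-≥ {suc n} f c h = ℕ.+-mono-≤ (h zero) (sum-≥ (f ∘ suc) c (h ∘ suc))

maximum : ∀ {n} (f : Fin (suc n) → ℕ) → ∃[ v ] ∀ i → f i ℕ.≤ f v
maximum {zero}  f = zero , λ { zero → ℕ.≤-refl }
maximum {suc n} f with maximum (f ∘ suc)
... | v , h with ℕ.≤-total (f zero) (f (suc v))
...   | inj₁ p = suc v , λ { zero → p ; (suc i) → h i }
...   | inj₂ p = zero , λ { zero → ℕ.≤-refl ; (suc i) → ℕ.≤-trans (h i) p }

minimum : ∀ {n} (f : Fin (suc n) → ℕ) → ∃[ v ] ∀ i → f v ℕ.≤ f i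
minimum {zero}  f = zero , λ { zero → ℕ.≤-refl }
minimum {suc n} f with minimum (f ∘ suc)
... | v , h with ℕ.≤-total (f zero) (f (suc v))
...   | inj₁ p = zero , λ { zero → ℕ.≤-refl ; (suc i) → ℕ.≤-trans p (h i) }
...   | inj₂ p = suc v , λ { zero → p ; (suc i) → h i }

good-delete-max : ∀ {n} (G : Graph (suc n)) k ℓ →
  ∃[ v ] good G k ℓ ℕ.* #kSubsets n k ℕ.≤ good (delete G v) k ℓ ℕ.* #kSubsets (suc n) k
good-delete-max {n} G k ℓ with maximum (λ v → good (delete G v) k ℓ)
... | v , h = v , ℕ.*-cancelˡ-≤ (suc n) (ℕ.+-cancelʳ-≤ (k ℕ.* K′ ℕ.* g) _ _ (begin
  suc n ℕ.* (g ℕ.* K) ℕ.+ k ℕ.* K′ ℕ.* g     ≡⟨ r₁ (suc n) g K k K′ ⟩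
  g ℕ.* (suc n ℕ.* K ℕ.+ k ℕ.* K′)           ≡⟨ cong (g ℕ.*_) (#kSubsets-suc n k) ⟩
  g ℕ.* (suc n ℕ.* K′)                       ≡⟨ r₂ g (suc n) K′ ⟩
  K′ ℕ.* (suc n ℕ.* g)                       ≡⟨ cong (K′ ℕ.*_) (sym (sum-good-delete G k ℓ)) ⟩
  K′ ℕ.* (sum f ℕ.+ k ℕ.* g)                 ≤⟨ ℕ.*-monoʳ-≤ K′ (ℕ.+-monoˡ-≤ (k ℕ.* g) (sum-≤ f (f v) h)) ⟩
  K′ ℕ.* (suc n ℕ.* f v ℕ.+ k ℕ.* g)         ≡⟨ r₃ K′ (suc n) (f v) k g ⟩
  suc n ℕ.* (f v ℕ.* K′) ℕ.+ k ℕ.* K′ ℕ.* g  ∎))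
  where
  open ℕ.≤-Reasoning
  f = λ v → good (delete G v) k ℓ
  g = good G k ℓ
  K = #kSubsets n k
  K′ = #kSubsets (suc n) k
  r₁ : ∀ n g K k K′ → n ℕ.* (g ℕ.* K) ℕ.+ k ℕ.* K′ ℕ.* g ≡ g ℕ.* (n ℕ.* K ℕ.+ k ℕ.* K′)
  r₁ = ℕ-Ring.solve-∀
  r₂ : ∀ g n K′ → g ℕ.* (n ℕ.* K′) ≡ K′ ℕ.* (n ℕ.* g)
  r₂ = ℕ-Ring.solve-∀
  r₃ : ∀ K′ n x k g → K′ ℕ.* (n ℕ.* x ℕ.+ k ℕ.* g) ≡ n ℕ.* (x ℕ.* K′) ℕ.+ k ℕ.* K′ ℕ.* g
  r₃ = ℕ-Ring.solve-∀

good-duplicate-max : ∀ {n} (G : Graph (suc n)) k ℓ →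
  ∃[ v ] suc n ℕ.* good G k ℓ ℕ.+ k ℕ.* good G k ℓ ℕ.≤ suc n ℕ.* good (duplicate G v) k ℓ
good-duplicate-max {n} G k ℓ with minimum (λ v → good (delete G v) k ℓ)
... | v , h = v , ℕ.+-cancelʳ-≤ (suc n ℕ.* g) _ _ (begin
  suc n ℕ.* g ℕ.+ k ℕ.* g ℕ.+ suc n ℕ.* g    ≡⟨ r₁ (suc n) g k ⟩
  suc n ℕ.* (g ℕ.+ g) ℕ.+ k ℕ.* g            ≤⟨ ℕ.+-monoˡ-≤ (k ℕ.* g) (ℕ.*-monoʳ-≤ (suc n) (good-duplicate G k ℓ v)) ⟩
  suc n ℕ.* (g′ ℕ.+ f v) ℕ.+ k ℕ.* g         ≡⟨ r₂ (suc n) g′ (f v) (k ℕ.* g) ⟩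
  suc n ℕ.* g′ ℕ.+ (suc n ℕ.* f v ℕ.+ k ℕ.* g)
    ≤⟨ ℕ.+-monoʳ-≤ (suc n ℕ.* g′) (ℕ.+-monoˡ-≤ (k ℕ.* g) (sum-≥ f (f v) h)) ⟩
  suc n ℕ.* g′ ℕ.+ (sum f ℕ.+ k ℕ.* g)       ≡⟨ cong (suc n ℕ.* g′ ℕ.+_) (sum-good-delete G k ℓ) ⟩
  suc n ℕ.* g′ ℕ.+ suc n ℕ.* g               ∎)
  where
  open ℕ.≤-Reasoning
  f = λ v → good (delete G v) k ℓ
  g = good G k ℓ
  g′ = good (duplicate G v) k ℓ
  r₁ : ∀ n g k → n ℕ.* g ℕ.+ k ℕ.* g ℕ.+ n ℕ.* g ≡ n ℕ.* (g ℕ.+ g) ℕ.+ k ℕ.* g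
  r₁ = ℕ-Ring.solve-∀
  r₂ : ∀ n x y z → n ℕ.* (x ℕ.+ y) ℕ.+ z ≡ n ℕ.* x ℕ.+ (n ℕ.* y ℕ.+ z)
  r₂ = ℕ-Ring.solve-∀

fraction-≤ : ∀ a b c d .{{_ : ℕ.NonZero b}} .{{_ : ℕ.NonZero d}} →
             a ℕ.* d ℕ.≤ c ℕ.* b → + a ℚ./ b ℚ.≤ + c ℚ./ d
fraction-≤ a (suc b) c (suc d) h = ℚ.toℚᵘ-cancel-≤ (begin
  ℚ.toℚᵘ (+ a ℚ./ suc b)  ≃⟨ ℚ.toℚᵘ-fromℚᵘ (ℚᵘ.mkℚᵘ (+ a) b) ⟩
  ℚᵘ.mkℚᵘ (+ a) b         ≤⟨ ℚᵘ.*≤* (subst₂ ℤ._≤_ (ℤ.pos-* a (suc d)) (ℤ.pos-* c (suc b)) (ℤ.+≤+ h)) ⟩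
  ℚᵘ.mkℚᵘ (+ c) d         ≃⟨ ℚᵘ.≃-sym (ℚ.toℚᵘ-fromℚᵘ (ℚᵘ.mkℚᵘ (+ c) d)) ⟩
  ℚ.toℚᵘ (+ c ℚ./ suc d)  ∎)
  where open ℚᵘ.≤-Reasoning

fraction-+ : ∀ a b c d .{{_ : ℕ.NonZero b}} .{{_ : ℕ.NonZero d}} →
             + a ℚ./ b ℚ.+ + c ℚ./ d ≡ (+ (a ℕ.* d ℕ.+ c ℕ.* b) ℚ./ (b ℕ.* d)) {{ℕ.m*n≢0 b d}}
fraction-+ a (suc b) c (suc d) = ℚ.toℚᵘ-injective (begin
  ℚ.toℚᵘ (+ a ℚ./ suc b ℚ.+ + c ℚ./ suc d)
    ≈⟨ ℚ.toℚᵘ-homo-+ (+ a ℚ./ suc b) (+ c ℚ./ suc d) ⟩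
  ℚ.toℚᵘ (+ a ℚ./ suc b) ℚᵘ.+ ℚ.toℚᵘ (+ c ℚ./ suc d)
    ≈⟨ ℚᵘ.+-cong (ℚ.toℚᵘ-fromℚᵘ (ℚᵘ.mkℚᵘ (+ a) b)) (ℚ.toℚᵘ-fromℚᵘ (ℚᵘ.mkℚᵘ (+ c) d)) ⟩
  ℚᵘ.mkℚᵘ (+ a) b ℚᵘ.+ ℚᵘ.mkℚᵘ (+ c) d
    ≡⟨ cong (λ z → ℚᵘ.mkℚᵘ z (d ℕ.+ b ℕ.* suc d))
         (cong₂ ℤ._+_ (sym (ℤ.pos-* a (suc d))) (sym (ℤ.pos-* c (suc b)))) ⟩
  ℚᵘ.mkℚᵘ (+ (a ℕ.* suc d ℕ.+ c ℕ.* suc b)) (d ℕ.+ b ℕ.* suc d)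
    ≈⟨ ℚᵘ.≃-sym (ℚ.toℚᵘ-fromℚᵘ _) ⟩
  ℚ.toℚᵘ (+ (a ℕ.* suc d ℕ.+ c ℕ.* suc b) ℚ./ (suc b ℕ.* suc d)) ∎)
  where open import Relation.Binary.Reasoning.Setoid ℚᵘ.≃-setoid

fraction-≥0 : ∀ a b .{{_ : ℕ.NonZero b}} → 0ℚ ℚ.≤ + a ℚ./ b
fraction-≥0 a b = fraction-≤ 0 1 a b z≤n

-- ℙ(X_{G,k} = ℓ), for a uniformly random k-subset of the vertices.
prob : ∀ {n} (G : Graph n) (k ℓ : ℕ) .(k≤n : k ℕ.≤ n) → ℚ
prob {n} G k ℓ k≤n =
  (+ length (filter (λ A → e G A ℕ.≟ ℓ) (kSubsets n k)) ℚ./ length (kSubsets n k)) {{#kSubsets-pos k≤n}}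

-- The default value 0ℚ does not affect the maximum: it is always attained by a
-- graph (I-attained).
I : ∀ n k ℓ .(k≤n : k ℕ.≤ n) → ℚ
I n k ℓ k≤n = max 0ℚ (map (λ G → prob G k ℓ k≤n) (allGraphs n))

prob-cong : ∀ {n} (G H : Graph n) k ℓ .(k≤n : k ℕ.≤ n) →
            (∀ i j → adj H i j ≡ adj G i j) → prob H k ℓ k≤n ≡ prob G k ℓ k≤n
prob-cong {n} G H k ℓ k≤n h = cong (λ g → (+ g ℚ./ #kSubsets n k) {{#kSubsets-pos k≤n}}) eq
  where
  eq : good H k ℓ ≡ good G k ℓ
  eq = trans (good-sum H k ℓ) (trans
    (sumˢ-cong (λ A → cong (λ c → 𝟙 (∣ A ∣ ℕ.≟ k) ℕ.* 𝟙 (c ℕ.≟ ℓ)) (e-cong G H h A)))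
    (sym (good-sum G k ℓ)))

≤-max : ∀ {q} xs → q ∈ˡ xs → q ℚ.≤ max 0ℚ xs
≤-max xs = All.lookup (xs≤max 0ℚ xs)

max-attained : ∀ xs → max 0ℚ xs ≡ 0ℚ ⊎ max 0ℚ xs ∈ˡ xs
max-attained = argmax-sel id 0ℚ

module _ {n} (k ℓ : ℕ) .(k≤n : k ℕ.≤ n) where

  private
    p : Graph n → ℚ
    p G = prob G k ℓ k≤n

  prob≤I : ∀ G → p G ℚ.≤ I n k ℓ k≤n
  prob≤I G = go (allGraphs-complete G)
    where
    go : (∃[ H ] H ∈ˡ allGraphs n × (∀ i j → adj H i j ≡ adj G i j)) → p G ℚ.≤ I n k ℓ k≤n
    go (H , H∈ , h) = ℚ.≤-trans (ℚ.≤-reflexive (sym (prob-cong G H k ℓ k≤n h)))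
      (≤-max (map p (allGraphs n)) (∈-map⁺ p H∈))

  I-attained : ∃[ G ] I n k ℓ k≤n ≡ p G
  I-attained = go (max-attained (map p (allGraphs n)))
    where
    G₀ : Graph n
    G₀ = record { adj = λ _ _ → false ; adj-sym = λ _ _ → refl ; adj-irrefl = λ _ → refl }

    p≥0 : 0ℚ ℚ.≤ p G₀
    p≥0 = fraction-≥0 (good G₀ k ℓ) (#kSubsets n k) {{#kSubsets-pos k≤n}}

    go : I n k ℓ k≤n ≡ 0ℚ ⊎ I n k ℓ k≤n ∈ˡ map p (allGraphs n) → ∃[ G ] I n k ℓ k≤n ≡ p G
    go (inj₁ I≡0) = G₀ , ℚ.≤-antisym (ℚ.≤-trans (ℚ.≤-reflexive I≡0) p≥0) (prob≤I G₀)
    go (inj₂ I∈) = proj₁ q , proj₂ (proj₂ q)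
      where q = ∈-map⁻ p I∈

I-decreasing : ∀ n k ℓ .(p : k ℕ.≤ n) .(q : k ℕ.≤ suc n) → I (suc n) k ℓ q ℚ.≤ I n k ℓ p
I-decreasing n k ℓ p q = begin
  I (suc n) k ℓ q          ≡⟨ proj₂ (I-attained k ℓ q) ⟩
  prob G k ℓ q             ≤⟨ fraction-≤ (good G k ℓ) (#kSubsets (suc n) k) (good (delete G v) k ℓ) (#kSubsets n k)
                                {{#kSubsets-pos q}} {{#kSubsets-pos p}} (proj₂ (good-delete-max G k ℓ)) ⟩
  prob (delete G v) k ℓ p  ≤⟨ prob≤I k ℓ p (delete G v) ⟩
  I n k ℓ p                ∎
  where
  open ℚ.≤-Reasoning
  G = proj₁ (I-attained k ℓ q)
  v = proj₁ (good-delete-max G k ℓ)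

cross-multiplied : ∀ N k g g′ r K′ →
  N ℕ.* g ℕ.+ k ℕ.* g ℕ.≤ N ℕ.* g′ →
  suc N ℕ.* (g ℕ.+ r) ℕ.+ k ℕ.* K′ ≡ suc N ℕ.* K′ →
  (g ℕ.* suc N ℕ.+ k ℕ.* k ℕ.* (g ℕ.+ r)) ℕ.* (K′ ℕ.* N)
    ℕ.≤ (g′ ℕ.* N ℕ.+ k ℕ.* k ℕ.* K′) ℕ.* ((g ℕ.+ r) ℕ.* suc N)
cross-multiplied N k g g′ r K′ h eq = ℕ.+-cancelʳ-≤ ((N ℕ.+ k) ℕ.* g ℕ.* (k ℕ.* K′)) _ _ (begin
  (g ℕ.* suc N ℕ.+ k ℕ.* k ℕ.* (g ℕ.+ r)) ℕ.* (K′ ℕ.* N) ℕ.+ (N ℕ.+ k) ℕ.* g ℕ.* (k ℕ.* K′)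
    ≤⟨ ℕ.m≤m+n _ (k ℕ.* g ℕ.* K′ ℕ.+ k ℕ.* k ℕ.* K′ ℕ.* r) ⟩
  (g ℕ.* suc N ℕ.+ k ℕ.* k ℕ.* (g ℕ.+ r)) ℕ.* (K′ ℕ.* N) ℕ.+ (N ℕ.+ k) ℕ.* g ℕ.* (k ℕ.* K′)
    ℕ.+ (k ℕ.* g ℕ.* K′ ℕ.+ k ℕ.* k ℕ.* K′ ℕ.* r)
    ≡⟨ r₁ N k g r K′ ⟩
  (N ℕ.* g ℕ.+ k ℕ.* g) ℕ.* (suc N ℕ.* K′) ℕ.+ k ℕ.* k ℕ.* K′ ℕ.* (g ℕ.+ r) ℕ.* suc N
    ≡⟨ cong (λ x → (N ℕ.* g ℕ.+ k ℕ.* g) ℕ.* x ℕ.+ k ℕ.* k ℕ.* K′ ℕ.* (g ℕ.+ r) ℕ.* suc N) (sym eq) ⟩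
  (N ℕ.* g ℕ.+ k ℕ.* g) ℕ.* (suc N ℕ.* (g ℕ.+ r) ℕ.+ k ℕ.* K′) ℕ.+ k ℕ.* k ℕ.* K′ ℕ.* (g ℕ.+ r) ℕ.* suc N
    ≡⟨ r₂ N k g r K′ ⟩
  (N ℕ.* g ℕ.+ k ℕ.* g) ℕ.* (suc N ℕ.* (g ℕ.+ r))
    ℕ.+ (k ℕ.* k ℕ.* K′ ℕ.* (g ℕ.+ r) ℕ.* suc N ℕ.+ (N ℕ.+ k) ℕ.* g ℕ.* (k ℕ.* K′))
    ≤⟨ ℕ.+-monoˡ-≤ _ (ℕ.*-monoˡ-≤ (suc N ℕ.* (g ℕ.+ r)) h) ⟩
  N ℕ.* g′ ℕ.* (suc N ℕ.* (g ℕ.+ r))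
    ℕ.+ (k ℕ.* k ℕ.* K′ ℕ.* (g ℕ.+ r) ℕ.* suc N ℕ.+ (N ℕ.+ k) ℕ.* g ℕ.* (k ℕ.* K′))
    ≡⟨ r₃ N k g g′ r K′ ⟩
  (g′ ℕ.* N ℕ.+ k ℕ.* k ℕ.* K′) ℕ.* ((g ℕ.+ r) ℕ.* suc N) ℕ.+ (N ℕ.+ k) ℕ.* g ℕ.* (k ℕ.* K′) ∎)
  where
  open ℕ.≤-Reasoning
  r₁ : ∀ N k g r K′ →
    (g ℕ.* suc N ℕ.+ k ℕ.* k ℕ.* (g ℕ.+ r)) ℕ.* (K′ ℕ.* N) ℕ.+ (N ℕ.+ k) ℕ.* g ℕ.* (k ℕ.* K′)
      ℕ.+ (k ℕ.* g ℕ.* K′ ℕ.+ k ℕ.* k ℕ.* K′ ℕ.* r)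
    ≡ (N ℕ.* g ℕ.+ k ℕ.* g) ℕ.* (suc N ℕ.* K′) ℕ.+ k ℕ.* k ℕ.* K′ ℕ.* (g ℕ.+ r) ℕ.* suc N
  r₁ = ℕ-Ring.solve-∀
  r₂ : ∀ N k g r K′ →
    (N ℕ.* g ℕ.+ k ℕ.* g) ℕ.* (suc N ℕ.* (g ℕ.+ r) ℕ.+ k ℕ.* K′) ℕ.+ k ℕ.* k ℕ.* K′ ℕ.* (g ℕ.+ r) ℕ.* suc N
    ≡ (N ℕ.* g ℕ.+ k ℕ.* g) ℕ.* (suc N ℕ.* (g ℕ.+ r))
      ℕ.+ (k ℕ.* k ℕ.* K′ ℕ.* (g ℕ.+ r) ℕ.* suc N ℕ.+ (N ℕ.+ k) ℕ.* g ℕ.* (k ℕ.* K′))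
  r₂ = ℕ-Ring.solve-∀
  r₃ : ∀ N k g g′ r K′ →
    N ℕ.* g′ ℕ.* (suc N ℕ.* (g ℕ.+ r))
      ℕ.+ (k ℕ.* k ℕ.* K′ ℕ.* (g ℕ.+ r) ℕ.* suc N ℕ.+ (N ℕ.+ k) ℕ.* g ℕ.* (k ℕ.* K′))
    ≡ (g′ ℕ.* N ℕ.+ k ℕ.* k ℕ.* K′) ℕ.* ((g ℕ.+ r) ℕ.* suc N) ℕ.+ (N ℕ.+ k) ℕ.* g ℕ.* (k ℕ.* K′)
  r₃ = ℕ-Ring.solve-∀

-- I (n , k , ℓ) − k² / n is non-decreasing in n: duplicate a vertex of an optimal
-- graph that lies in the largest number of k-subsets with exactly ℓ edges.
I-drop : ∀ n k ℓ (p : k ℕ.≤ suc n) (q : k ℕ.≤ suc (suc n)) →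
         I (suc n) k ℓ p ℚ.+ + (k ℕ.* k) ℚ./ suc (suc n) ℚ.≤ I (suc (suc n)) k ℓ q ℚ.+ + (k ℕ.* k) ℚ./ suc n
I-drop n k ℓ p q = begin
  I N k ℓ p ℚ.+ + c ℚ./ suc N
    ≡⟨ cong (ℚ._+ + c ℚ./ suc N) (proj₂ (I-attained k ℓ p)) ⟩
  (+ g ℚ./ K) ℚ.+ + c ℚ./ suc N
    ≡⟨ fraction-+ g K c (suc N) ⟩
  (+ (g ℕ.* suc N ℕ.+ c ℕ.* K) ℚ./ (K ℕ.* suc N)) {{nz₁}}
    ≤⟨ fraction-≤ (g ℕ.* suc N ℕ.+ c ℕ.* K) (K ℕ.* suc N) (g′ ℕ.* N ℕ.+ c ℕ.* K′) (K′ ℕ.* N)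
         {{nz₁}} {{nz₂}} cross ⟩
  (+ (g′ ℕ.* N ℕ.+ c ℕ.* K′) ℚ./ (K′ ℕ.* N)) {{nz₂}}
    ≡⟨ sym (fraction-+ g′ K′ c N) ⟩
  (+ g′ ℚ./ K′) ℚ.+ + c ℚ./ N
    ≤⟨ ℚ.+-monoˡ-≤ (+ c ℚ./ N) (prob≤I k ℓ q (duplicate G v)) ⟩
  I (suc N) k ℓ q ℚ.+ + c ℚ./ N ∎
  where
  open ℚ.≤-Reasoning
  N = suc n
  G = proj₁ (I-attained k ℓ p)
  v = proj₁ (good-duplicate-max G k ℓ)
  c = k ℕ.* k
  g = good G k ℓ
  g′ = good (duplicate G v) k ℓ
  K = #kSubsets N k
  K′ = #kSubsets (suc N) k
  instance
    K≢0 : ℕ.NonZero K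
    K≢0 = #kSubsets-pos p
    K′≢0 : ℕ.NonZero K′
    K′≢0 = #kSubsets-pos q
  nz₁ = ℕ.m*n≢0 K (suc N)
  nz₂ = ℕ.m*n≢0 K′ N

  r = K ℕ.∸ g
  K≡g+r : K ≡ g ℕ.+ r
  K≡g+r = sym (ℕ.m+[n∸m]≡n (good≤ G k ℓ))

  cross : (g ℕ.* suc N ℕ.+ c ℕ.* K) ℕ.* (K′ ℕ.* N) ℕ.≤ (g′ ℕ.* N ℕ.+ c ℕ.* K′) ℕ.* (K ℕ.* suc N)
  cross = subst (λ K → (g ℕ.* suc N ℕ.+ c ℕ.* K) ℕ.* (K′ ℕ.* N) ℕ.≤ (g′ ℕ.* N ℕ.+ c ℕ.* K′) ℕ.* (K ℕ.* suc N))
    (sym K≡g+r)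
    (cross-multiplied N k g g′ r K′ (proj₂ (good-duplicate-max G k ℓ))
      (subst (λ K → suc N ℕ.* K ℕ.+ k ℕ.* K′ ≡ suc N ℕ.* K′) K≡g+r (#kSubsets-suc N k)))

Cauchy : (ℕ → ℚ) → Set
Cauchy u = ∀ ε → 0ℚ ℚ.< ε → ∃[ N ] (∀ m n → N ℕ.≤ m → N ℕ.≤ n → ℚ.∣ u m ℚ.- u n ∣ ℚ.< ε)

record ℝ : Set where
  constructor mkℝ
  field
    seq    : ℕ → ℚ
    cauchy : Cauchy seq

open ℝ public

infix 4 _<ℝ_ _⟶_
infixl 6 _-ℝ_

-- Without the uniform gap δ the relation would depend on the chosen
-- representatives.
_<ℝ_ : ℝ → ℝ → Set
x <ℝ y = ∃[ δ ] 0ℚ ℚ.< δ × ∃[ N ] (∀ n → N ℕ.≤ n → seq x n ℚ.+ δ ℚ.≤ seq y n)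

fromℚ : ℚ → ℝ
fromℚ q = mkℝ (λ _ → q) (λ ε 0<ε → 0 , λ _ _ _ _ →
  subst (λ z → ℚ.∣ z ∣ ℚ.< ε) (sym (ℚ.+-inverseʳ q)) 0<ε)

0ℝ 1ℝ : ℝ
0ℝ = fromℚ 0ℚ
1ℝ = fromℚ 1ℚ

halves : ∀ ε → ε ℚ.* ½ ℚ.+ ε ℚ.* ½ ≡ ε
halves ε = trans (sym (ℚ.*-distribˡ-+ ε ½ ½)) (ℚ.*-identityʳ ε)

half-pos : ∀ {ε} → 0ℚ ℚ.< ε → 0ℚ ℚ.< ε ℚ.* ½
half-pos {ε} 0<ε = subst (ℚ._< ε ℚ.* ½) (ℚ.*-zeroˡ ½) (ℚ.*-monoˡ-<-pos ½ 0<ε)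

_-ℝ_ : ℝ → ℝ → ℝ
x -ℝ y = mkℝ (λ n → seq x n ℚ.- seq y n) c
  where
  open +-*-Solver

  c : Cauchy (λ n → seq x n ℚ.- seq y n)
  c ε 0<ε = proj₁ X ℕ.⊔ proj₁ Y , λ m n p q → begin-strict
    ℚ.∣ (seq x m ℚ.- seq y m) ℚ.- (seq x n ℚ.- seq y n) ∣
      ≡⟨ cong ℚ.∣_∣ (solve 4 (λ a b c d → (a :- b) :- (c :- d) := (a :- c) :- (b :- d)) refl
           (seq x m) (seq y m) (seq x n) (seq y n)) ⟩
    ℚ.∣ (seq x m ℚ.- seq x n) ℚ.- (seq y m ℚ.- seq y n) ∣
      ≤⟨ ℚ.∣p-q∣≤∣p∣+∣q∣ (seq x m ℚ.- seq x n) (seq y m ℚ.- seq y n) ⟩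
    ℚ.∣ seq x m ℚ.- seq x n ∣ ℚ.+ ℚ.∣ seq y m ℚ.- seq y n ∣
      <⟨ ℚ.+-mono-< (proj₂ X m n (ℕ.m⊔n≤o⇒m≤o (proj₁ X) (proj₁ Y) p) (ℕ.m⊔n≤o⇒m≤o (proj₁ X) (proj₁ Y) q))
                    (proj₂ Y m n (ℕ.m⊔n≤o⇒n≤o (proj₁ X) (proj₁ Y) p) (ℕ.m⊔n≤o⇒n≤o (proj₁ X) (proj₁ Y) q)) ⟩
    ε ℚ.* ½ ℚ.+ ε ℚ.* ½
      ≡⟨ halves ε ⟩
    ε ∎
    where
    open ℚ.≤-Reasoning
    X = cauchy x (ε ℚ.* ½) (half-pos 0<ε)
    Y = cauchy y (ε ℚ.* ½) (half-pos 0<ε)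

_⟶_ : (ℕ → ℚ) → ℝ → Set
u ⟶ x = ∀ ε → 0ℚ ℚ.< ε → ∃[ N ] (∀ n → N ℕ.≤ n →
  fromℚ (u n ℚ.- ε) <ℝ x × x <ℝ fromℚ (u n ℚ.+ ε))

-- A Cauchy sequence of rationals converges to the real number it represents
-- (lim-converges).
lim : (u : ℕ → ℚ) → Cauchy u → ℝ
lim = mkℝ

∣∣<⇒< : ∀ {p ε} → ℚ.∣ p ∣ ℚ.< ε → p ℚ.< ε
∣∣<⇒< {p} {ε} h with ℚ.≤-total 0ℚ p
... | inj₁ 0≤p = subst (ℚ._< ε) (ℚ.0≤p⇒∣p∣≡p 0≤p) h
... | inj₂ p≤0 = ℚ.≤-<-trans p≤0 (ℚ.≤-<-trans (ℚ.0≤∣p∣ p) h)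

lim-converges : ∀ u (c : Cauchy u) → u ⟶ lim u c
lim-converges u c ε 0<ε = N , λ n N≤n →
    (η , 0<η , N , λ m N≤m → lower (u n) (u m) (ℚ.<⇒≤ (∣∣<⇒< (close n m N≤n N≤m))))
  , (η , 0<η , N , λ m N≤m → upper (u n) (u m) (ℚ.<⇒≤ (∣∣<⇒< (close m n N≤m N≤n))))
  where
  open ℚ.≤-Reasoning
  open +-*-Solver
  η = ε ℚ.* ½
  0<η = half-pos 0<ε
  N = proj₁ (c η 0<η)
  close = proj₂ (c η 0<η)

  lower : ∀ a b → a ℚ.- b ℚ.≤ η → a ℚ.- ε ℚ.+ η ℚ.≤ b
  lower a b h = begin
    a ℚ.- ε ℚ.+ η               ≡⟨ cong (λ z → a ℚ.- z ℚ.+ η) (sym (halves ε)) ⟩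
    a ℚ.- (η ℚ.+ η) ℚ.+ η       ≡⟨ solve 3 (λ a b η → a :- (η :+ η) :+ η := (a :- b) :+ (b :- η)) refl a b η ⟩
    (a ℚ.- b) ℚ.+ (b ℚ.- η)     ≤⟨ ℚ.+-monoˡ-≤ (b ℚ.- η) h ⟩
    η ℚ.+ (b ℚ.- η)             ≡⟨ solve 2 (λ b η → η :+ (b :- η) := b) refl b η ⟩
    b                           ∎

  upper : ∀ a b → b ℚ.- a ℚ.≤ η → b ℚ.+ η ℚ.≤ a ℚ.+ ε
  upper a b h = begin
    b ℚ.+ η                     ≡⟨ solve 3 (λ a b η → b :+ η := (b :- a) :+ (a :+ η)) refl a b η ⟩
    (b ℚ.- a) ℚ.+ (a ℚ.+ η)     ≤⟨ ℚ.+-monoˡ-≤ (a ℚ.+ η) h ⟩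
    η ℚ.+ (a ℚ.+ η)             ≡⟨ solve 2 (λ a η → η :+ (a :+ η) := a :+ (η :+ η)) refl a η ⟩
    a ℚ.+ (η ℚ.+ η)             ≡⟨ cong (a ℚ.+_) (halves ε) ⟩
    a ℚ.+ ε                     ∎

-- If u is non-increasing, u − b is non-decreasing, and b is non-negative and
-- tends to 0, then u is Cauchy.
module _ (u b : ℕ → ℚ)
  (u↓ : ∀ m → u (suc m) ℚ.≤ u m)
  (u-b↑ : ∀ m → u m ℚ.+ b (suc m) ℚ.≤ u (suc m) ℚ.+ b m)
  (b≥0 : ∀ m → 0ℚ ℚ.≤ b m)
  (b→0 : ∀ ε → 0ℚ ℚ.< ε → ∃[ N ] (∀ m → N ℕ.≤ m → b m ℚ.< ε))
  where

  private
    open +-*-Solver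
    open ℚ.≤-Reasoning

    decreasing : ∀ t m → u (t ℕ.+ m) ℚ.≤ u m
    decreasing zero    m = ℚ.≤-refl
    decreasing (suc t) m = ℚ.≤-trans (u↓ (t ℕ.+ m)) (decreasing t m)

    increasing : ∀ t m → u m ℚ.- b m ℚ.≤ u (t ℕ.+ m) ℚ.- b (t ℕ.+ m)
    increasing zero    m = ℚ.≤-refl
    increasing (suc t) m = ℚ.≤-trans (increasing t m) (move (u (t ℕ.+ m)) (u (suc t ℕ.+ m)) (b (t ℕ.+ m)) (b (suc t ℕ.+ m)) (u-b↑ (t ℕ.+ m)))
      where
      move : ∀ x y c d → x ℚ.+ d ℚ.≤ y ℚ.+ c → x ℚ.- c ℚ.≤ y ℚ.- d
      move x y c d h = begin
        x ℚ.- c                        ≡⟨ solve 3 (λ x c d → x :- c := (x :+ d) :+ (:- c :+ :- d)) refl x c d ⟩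
        (x ℚ.+ d) ℚ.+ (ℚ.- c ℚ.+ ℚ.- d)  ≤⟨ ℚ.+-monoˡ-≤ (ℚ.- c ℚ.+ ℚ.- d) h ⟩
        (y ℚ.+ c) ℚ.+ (ℚ.- c ℚ.+ ℚ.- d)  ≡⟨ solve 3 (λ y c d → (y :+ c) :+ (:- c :+ :- d) := y :- d) refl y c d ⟩
        y ℚ.- d                        ∎

    ordered : ∀ m t → ℚ.∣ u m ℚ.- u (t ℕ.+ m) ∣ ℚ.≤ b m
    ordered m t = begin
      ℚ.∣ x ℚ.- y ∣               ≡⟨ ℚ.0≤p⇒∣p∣≡p (subst (ℚ._≤ x ℚ.- y) (ℚ.+-inverseʳ y)
                                       (ℚ.+-monoˡ-≤ (ℚ.- y) (decreasing t m))) ⟩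
      x ℚ.- y                     ≡⟨ solve 3 (λ x y c → x :- y := (x :- c) :+ (c :- y)) refl x y (b m) ⟩
      (x ℚ.- b m) ℚ.+ (b m ℚ.- y)  ≤⟨ ℚ.+-monoˡ-≤ (b m ℚ.- y) (increasing t m) ⟩
      (y ℚ.- d) ℚ.+ (b m ℚ.- y)    ≡⟨ solve 3 (λ y d c → (y :- d) :+ (c :- y) := c :+ :- d) refl y d (b m) ⟩
      b m ℚ.+ ℚ.- d                ≤⟨ ℚ.+-monoʳ-≤ (b m) (ℚ.neg-antimono-≤ (b≥0 (t ℕ.+ m))) ⟩
      b m ℚ.+ ℚ.- 0ℚ               ≡⟨ ℚ.+-identityʳ (b m) ⟩
      b m                         ∎
      where
      x = u m
      y = u (t ℕ.+ m)
      d = b (t ℕ.+ m)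

    ordered′ : ∀ {m n} → m ℕ.≤ n → ℚ.∣ u m ℚ.- u n ∣ ℚ.≤ b m
    ordered′ {m} {n} m≤n = subst (λ i → ℚ.∣ u m ℚ.- u i ∣ ℚ.≤ b m) (ℕ.m∸n+n≡m m≤n) (ordered m (n ℕ.∸ m))

  sandwiched⇒Cauchy : Cauchy u
  sandwiched⇒Cauchy ε 0<ε = N , close
    where
    N = proj₁ (b→0 ε 0<ε)
    b<ε = proj₂ (b→0 ε 0<ε)

    close : ∀ m n → N ℕ.≤ m → N ℕ.≤ n → ℚ.∣ u m ℚ.- u n ∣ ℚ.< ε
    close m n p q with ℕ.≤-total m n
    ... | inj₁ m≤n = ℚ.≤-<-trans (ordered′ m≤n) (b<ε m p)
    ... | inj₂ n≤m = subst (ℚ._< ε)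
      (trans (sym (ℚ.∣-p∣≡∣p∣ (u n ℚ.- u m)))
             (cong ℚ.∣_∣ (solve 2 (λ a b → :- (a :- b) := b :- a) refl (u n) (u m))))
      (ℚ.≤-<-trans (ordered′ n≤m) (b<ε n q))

Cauchy-tail : ∀ u → Cauchy (u ∘ suc) → Cauchy u
Cauchy-tail u c ε 0<ε = suc (proj₁ (c ε 0<ε)) ,
  λ { (suc m) (suc n) (s≤s p) (s≤s q) → proj₂ (c ε 0<ε) m n p q }

fraction-small : ∀ c k ε → 0ℚ ℚ.< ε → ∃[ N ] (∀ m → N ℕ.≤ m → + c ℚ./ suc (m ℕ.+ k) ℚ.< ε)
fraction-small c k ε@(ℚ.mkℚ (+ zero) d _) (ℚ.*<* (ℤ.+<+ ()))
fraction-small c k ε@(ℚ.mkℚ (+ suc a) d _) _ = c ℕ.* suc d , λ m h → ℚ.toℚᵘ-cancel-< (ℚᵘ.<-respˡ-≃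
  (ℚᵘ.≃-sym (ℚ.toℚᵘ-fromℚᵘ (ℚᵘ.mkℚᵘ (+ c) (m ℕ.+ k))))
  (ℚᵘ.*<* (subst₂ ℤ._<_ (ℤ.pos-* c (suc d)) (ℤ.pos-* (suc a) (suc (m ℕ.+ k))) (ℤ.+<+ (begin-strict
    c ℕ.* suc d                ≤⟨ h ⟩
    m                          <⟨ s≤s (ℕ.m≤m+n m k) ⟩
    suc (m ℕ.+ k)              ≤⟨ ℕ.m≤m+n _ _ ⟩
    suc a ℕ.* suc (m ℕ.+ k)    ∎)))))
  where open ℕ.≤-Reasoning
fraction-small c k (ℚ.mkℚ ℤ.-[1+ _ ] d _) (ℚ.*<* ())

-- m ↦ I (m + k , k , ℓ), so that n = m + k runs over the integers n ≥ k.
I-seq : ℕ → ℕ → ℕ → ℚ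
I-seq k ℓ m = I (m ℕ.+ k) k ℓ (ℕ.m≤n+m k m)

I-seq-cauchy : ∀ k ℓ → Cauchy (I-seq k ℓ)
I-seq-cauchy k ℓ = Cauchy-tail (I-seq k ℓ) (sandwiched⇒Cauchy
  (I-seq k ℓ ∘ suc)
  (λ m → + (k ℕ.* k) ℚ./ suc (m ℕ.+ k))
  (λ m → I-decreasing (suc m ℕ.+ k) k ℓ (ℕ.m≤n+m k (suc m)) (ℕ.m≤n+m k (suc (suc m))))
  (λ m → I-drop (m ℕ.+ k) k ℓ (ℕ.m≤n+m k (suc m)) (ℕ.m≤n+m k (suc (suc m))))
  (λ m → fraction-≥0 (k ℕ.* k) (suc (m ℕ.+ k)))
  (fraction-small (k ℕ.* k) k))

ind : ℕ → ℕ → ℝ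
ind k ℓ = lim (I-seq k ℓ) (I-seq-cauchy k ℓ)

ind-limit : ∀ k ℓ → I-seq k ℓ ⟶ ind k ℓ
ind-limit k ℓ = lim-converges (I-seq k ℓ) (I-seq-cauchy k ℓ)

{-# OPTIONS --safe #-}
-- Since I (n , k , ℓ) is non-increasing in n, it suffices to bound it at n = 2k.
-- If a graph G on 2k vertices has two vertices u, w that are not twins, then for
-- every (k−1)-set B avoiding them on which their degrees differ, B ∪ {u} and
-- B ∪ {w} do not both span ℓ edges. The difference of these degrees is a linear
-- functional of B, and exchanging two vertices once more shows that it is
-- non-zero for at least C(2k−4 , k−2) of the sets B, hence for a proportion of at
-- least 1/16 of the number C(2k , k) of all k-sets. If all pairs are twins, then G
-- is empty or complete and X = ℓ never happens.
module Submission where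

open import Defs
open import Data.Nat.Base using (ℕ; _<_)
open import Data.Nat.Combinatorics using (_C_)
open import Data.Product using (∃-syntax; _×_)

open import Data.Bool.Base using (Bool; true; false; T)
open import Data.Bool.Properties as Bool using (T?)
open import Data.Fin.Base using (Fin; zero; suc; punchIn; punchOut)
import Data.Fin.Properties as Fin
open import Data.Fin.Subset using (Subset; inside; outside; _∈_; ∣_∣)
open import Data.Fin.Subset.Properties using (_∈?_)
import Data.Integer.Base as ℤ
open import Data.Nat.Base using (zero; suc; _+_; _*_; _∸_; _≤_; z≤n; s≤s)
open import Data.Nat.Combinatorics using (nC1≡n; nCk+nC[k+1]≡[n+1]C[k+1])
open import Data.Nat.Properties
open import Data.Nat.Tactic.RingSolver using (solve-∀)
open import Data.Product using (_,_; proj₁; proj₂)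
open import Data.Rational.Base as ℚ using (0ℚ)
import Data.Rational.Properties as ℚ
open import Data.Sum.Base using (_⊎_; inj₁; inj₂)
open import Data.Vec.Base using (_∷_; []; insertAt)
import Data.Vec.Properties as Vec
open import Function.Base using (_∘_)
open import Relation.Binary.Definitions using (tri<; tri≈; tri>)
open import Relation.Binary.PropositionalEquality
open import Relation.Nullary using (¬_; Dec; yes; no; contradiction; ¬?)
open import Relation.Nullary.Decidable using (_×-dec_)
open import Algebra.Properties.Semiring.Sum +-*-semiring
  using (sum; sum-cong-≗; sum-remove; ∑-distrib-+)

-- Counting sets by exchanging two vertices

count : ∀ {n} {P : Subset n → Set} → (∀ A → Dec (P A)) → ℕ
count P? = sumˢ (λ A → 𝟙 (P? A))

𝟙-⊎ : ∀ {P Q R : Set} (p : Dec P) (q : Dec Q) (r : Dec R) → (P → Q ⊎ R) → 𝟙 p ≤ 𝟙 q + 𝟙 r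
𝟙-⊎ (no _)  q       r       h = z≤n
𝟙-⊎ (yes a) (yes _) r       h = s≤s z≤n
𝟙-⊎ (yes a) (no _)  (yes _) h = s≤s z≤n
𝟙-⊎ (yes a) (no ¬b) (no ¬c) h with h a
... | inj₁ b = contradiction b ¬b
... | inj₂ c = contradiction c ¬c

𝟙-× : ∀ {P Q : Set} (p : Dec P) (q : Dec Q) → 𝟙 (p ×-dec q) ≡ 𝟙 p * 𝟙 q
𝟙-× (yes _) (yes _) = refl
𝟙-× (yes _) (no _)  = refl
𝟙-× (no _)  _       = refl

sumˢ-insertAt : ∀ {n} (v : Fin (suc n)) (F : Subset (suc n) → ℕ) →
  sumˢ F ≡ sumˢ (λ B → F (insertAt B v inside)) + sumˢ (λ B → F (insertAt B v outside))
sumˢ-insertAt zero F = refl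
sumˢ-insertAt {suc n} (suc v) F = trans
  (cong₂ _+_ (sumˢ-insertAt v (F ∘ (inside ∷_))) (sumˢ-insertAt v (F ∘ (outside ∷_))))
  (swap (sumˢ (λ B → F (inside ∷ insertAt B v inside))) _ _ _)
  where
  swap : ∀ a b c d → (a + b) + (c + d) ≡ (a + c) + (b + d)
  swap = solve-∀

-- The two sets produced from D differ by an exchange of the vertices u and
-- punchIn u w, so distinct D produce disjoint pairs.
only-left only-right : ∀ {n} → Fin (suc (suc n)) → Fin (suc n) → Subset n → Subset (suc (suc n))
only-left  u w D = insertAt (insertAt D w outside) u inside
only-right u w D = insertAt (insertAt D w inside) u outside

-- Membership of `u` and `punchIn u w` splits `count P?` into four sums. The two mixed ones run over
-- the `only-left` and `only-right` sets, and every `D` with `Q D` contributes to at least one of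
-- them.
count-exchange : ∀ {n} {P : Subset (suc (suc n)) → Set} {Q : Subset n → Set}
  (P? : ∀ A → Dec (P A)) (Q? : ∀ D → Dec (Q D)) u w →
  (∀ D → Q D → P (only-left u w D) ⊎ P (only-right u w D)) → count Q? ≤ count P?
count-exchange P? Q? u w h = begin
  count Q?
    ≤⟨ sumˢ-mono (λ D → 𝟙-⊎ (Q? D) (P? (only-left u w D)) (P? (only-right u w D)) (h D)) ⟩
  sumˢ (λ D → F (only-left u w D) + F (only-right u w D))
    ≡⟨ sumˢ-+ (F ∘ only-left u w) (F ∘ only-right u w) ⟩
  sumˢ (F ∘ only-left u w) + sumˢ (F ∘ only-right u w)
    ≤⟨ +-mono-≤ (m≤n+m _ (at inside inside)) (m≤m+n _ (at outside outside)) ⟩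
  (at inside inside + at inside outside) + (at outside inside + at outside outside)
    ≡⟨ sym (cong₂ _+_ (sumˢ-insertAt w (λ B → F (insertAt B u inside)))
                      (sumˢ-insertAt w (λ B → F (insertAt B u outside)))) ⟩
  sumˢ (λ B → F (insertAt B u inside)) + sumˢ (λ B → F (insertAt B u outside))
    ≡⟨ sym (sumˢ-insertAt u F) ⟩
  count P? ∎
  where
  open ≤-Reasoning
  F = λ A → 𝟙 (P? A)
  at = λ s t → sumˢ (λ D → F (insertAt (insertAt D w t) u s))

∣insertAt-inside∣ : ∀ {n} (v : Fin (suc n)) (B : Subset n) → ∣ insertAt B v inside ∣ ≡ suc ∣ B ∣
∣insertAt-inside∣ zero    B             = refl
∣insertAt-inside∣ (suc v) (inside ∷ B)  = cong suc (∣insertAt-inside∣ v B)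
∣insertAt-inside∣ (suc v) (outside ∷ B) = ∣insertAt-inside∣ v B

∣only-left∣ : ∀ {n} u w (D : Subset n) → ∣ only-left u w D ∣ ≡ suc ∣ D ∣
∣only-left∣ u w D = trans (∣insertAt-inside∣ u _) (cong suc (∣without∣ w D))

∣only-right∣ : ∀ {n} u w (D : Subset n) → ∣ only-right u w D ∣ ≡ suc ∣ D ∣
∣only-right∣ u w D = trans (∣without∣ u _) (∣insertAt-inside∣ w D)

-- Linear functionals of a set

wsum : ∀ {n} → (Fin n → ℕ) → Subset n → ℕ
wsum f A = sum (λ i → 𝟙 (i ∈? A) * f i)

∈-insertAt⁻ : ∀ {n} (v : Fin (suc n)) {i : Fin n} {B : Subset n} {s} → punchIn v i ∈ insertAt B v s → i ∈ B
∈-insertAt⁻ v {i} {B} {s} p = Vec.lookup⇒[]= i B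
  (trans (sym (Vec.insertAt-punchIn B v s i)) (Vec.[]=⇒lookup p))

∈-insertAt⁺ : ∀ {n} (v : Fin (suc n)) {i : Fin n} {B : Subset n} {s} → i ∈ B → punchIn v i ∈ insertAt B v s
∈-insertAt⁺ v {i} {B} {s} p = Vec.lookup⇒[]= (punchIn v i) _
  (trans (Vec.insertAt-punchIn B v s i) (Vec.[]=⇒lookup p))

v∈insertAt : ∀ {n} (v : Fin (suc n)) (B : Subset n) → v ∈ insertAt B v inside
v∈insertAt v B = Vec.lookup⇒[]= v _ (Vec.insertAt-lookup B v inside)

v∉insertAt : ∀ {n} (v : Fin (suc n)) (B : Subset n) → ¬ v ∈ insertAt B v outside
v∉insertAt v B p with trans (sym (Vec.insertAt-lookup B v outside)) (Vec.[]=⇒lookup p)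
... | ()

𝟙-yes : ∀ {P : Set} (p : Dec P) → P → 𝟙 p ≡ 1
𝟙-yes (yes _) _ = refl
𝟙-yes (no ¬a) a = contradiction a ¬a

wsum-insertAt : ∀ {n} (f : Fin (suc n) → ℕ) v (B : Subset n) s →
  wsum f (insertAt B v s) ≡ 𝟙 (v ∈? insertAt B v s) * f v + wsum (f ∘ punchIn v) B
wsum-insertAt f v B s = trans (sum-remove {i = v} (λ i → 𝟙 (i ∈? insertAt B v s) * f i))
  (cong (𝟙 (v ∈? insertAt B v s) * f v +_) (sum-cong-≗ (λ i → cong (_* f (punchIn v i))
    (𝟙-cong (punchIn v i ∈? insertAt B v s) (i ∈? B) (∈-insertAt⁻ v) (∈-insertAt⁺ v)))))

wsum-inside : ∀ {n} (f : Fin (suc n) → ℕ) v (B : Subset n) →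
  wsum f (insertAt B v inside) ≡ f v + wsum (f ∘ punchIn v) B
wsum-inside f v B = trans (wsum-insertAt f v B inside)
  (cong (_+ wsum (f ∘ punchIn v) B) 
    (trans (cong (_* f v) (𝟙-yes (v ∈? insertAt B v inside) (v∈insertAt v B))) (*-identityˡ (f v))))

wsum-outside : ∀ {n} (f : Fin (suc n) → ℕ) v (B : Subset n) →
  wsum f (insertAt B v outside) ≡ wsum (f ∘ punchIn v) B
wsum-outside f v B = trans (wsum-insertAt f v B outside)
  (cong (_+ wsum (f ∘ punchIn v) B) (cong (_* f v) (𝟙-no (v ∈? insertAt B v outside) (v∉insertAt v B))))

wsum-left : ∀ {n} (f : Fin (suc (suc n)) → ℕ) u w (D : Subset n) →
  wsum f (only-left u w D) ≡ f u + wsum (f ∘ punchIn u ∘ punchIn w) D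
wsum-left f u w D = trans (wsum-inside f u _) (cong (f u +_) (wsum-outside (f ∘ punchIn u) w D))

wsum-right : ∀ {n} (f : Fin (suc (suc n)) → ℕ) u w (D : Subset n) →
  wsum f (only-right u w D) ≡ f (punchIn u w) + wsum (f ∘ punchIn u ∘ punchIn w) D
wsum-right f u w D = trans (wsum-outside f u _) (wsum-inside (f ∘ punchIn u) w D)

-- The hypothesis says that f - g is the constant a - b, so its sum over `B` is `∣ B ∣` times that
-- constant; both are written without subtraction to stay in ℕ.
wsum-shift : ∀ {n} (f g : Fin n → ℕ) a b → (∀ i → a + g i ≡ b + f i) →
  ∀ B → ∣ B ∣ * a + wsum g B ≡ ∣ B ∣ * b + wsum f B
wsum-shift f g a b h []            = refl
wsum-shift f g a b h (outside ∷ B) = wsum-shift (f ∘ suc) (g ∘ suc) a b (h ∘ suc) B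
wsum-shift f g a b h (inside ∷ B)  = begin
  suc ∣ B ∣ * a + wsum g (inside ∷ B)         ≡⟨ cong (suc ∣ B ∣ * a +_) (wsum-inside g zero B) ⟩
  suc ∣ B ∣ * a + (g zero + wsum g⁺ B)        ≡⟨ r a ∣ B ∣ (g zero) (wsum g⁺ B) ⟩
  (a + g zero) + (∣ B ∣ * a + wsum g⁺ B)      ≡⟨ cong₂ _+_ (h zero) (wsum-shift f⁺ g⁺ a b (h ∘ suc) B) ⟩
  (b + f zero) + (∣ B ∣ * b + wsum f⁺ B)      ≡⟨ sym (r b ∣ B ∣ (f zero) (wsum f⁺ B)) ⟩
  suc ∣ B ∣ * b + (f zero + wsum f⁺ B)        ≡⟨ cong (suc ∣ B ∣ * b +_) (sym (wsum-inside f zero B)) ⟩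
  suc ∣ B ∣ * b + wsum f (inside ∷ B)         ∎
  where
  open ≡-Reasoning
  f⁺ = f ∘ suc
  g⁺ = g ∘ suc
  r : ∀ a m x y → suc m * a + (x + y) ≡ (a + x) + (m * a + y)
  r = solve-∀

differ? : ∀ {n} (f g : Fin n → ℕ) m (B : Subset n) → Dec (∣ B ∣ ≡ m × ¬ wsum f B ≡ wsum g B)
differ? f g m B = (∣ B ∣ ≟ m) ×-dec ¬? (wsum f B ≟ wsum g B)

-- Either f - g differs from its value at `x` somewhere, or it is constant. A vertex where it
-- differs is not `x`, hence has the form `punchIn x y` that an exchange needs.
∃-unbalanced : ∀ {n} (f g : Fin (suc (suc n)) → ℕ) x →
  (∃[ y ] ¬ f x + g (punchIn x y) ≡ g x + f (punchIn x y)) ⊎ (∀ i → f x + g i ≡ g x + f i)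
∃-unbalanced f g x with Fin.all? (λ i → f x + g i ≟ g x + f i)
... | yes h = inj₂ h
... | no ¬h with Fin.¬∀⟶∃¬ _ _ (λ i → f x + g i ≟ g x + f i) ¬h
...   | i , i-unbalanced = inj₁ (punchOut x≢i ,
        subst (λ j → ¬ f x + g j ≡ g x + f j) (sym (Fin.punchIn-punchOut x≢i)) i-unbalanced)
  where
  x≢i : ¬ x ≡ i
  x≢i refl = i-unbalanced (+-comm (f x) (g x))

-- If f − g is not constant, choose y with f x − g x ≠ f y − g y: then f − g sums to
-- different values on the two exchanged sets. If it is constant, it is a non-zero
-- constant and no non-empty set has sum zero.
count-differ : ∀ {n} (f g : Fin (suc (suc n)) → ℕ) m x → ¬ f x ≡ g x →
  #kSubsets n m ≤ count (differ? f g (suc m))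
count-differ {n} f g m x fx≢gx = subst (_≤ count (differ? f g (suc m))) (sym (#kSubsets-sum n m))
  (go (∃-unbalanced f g x))
  where
  open ≡-Reasoning

  go : (∃[ y ] ¬ f x + g (punchIn x y) ≡ g x + f (punchIn x y)) ⊎ (∀ i → f x + g i ≡ g x + f i) →
       count {n} (λ D → ∣ D ∣ ≟ m) ≤ count (differ? f g (suc m))
  -- The exchange partner `zero` is arbitrary: the left set is non-empty, so it always satisfies the
  -- predicate.
  go (inj₂ balanced) = count-exchange (differ? f g (suc m)) (λ D → ∣ D ∣ ≟ m) x zero λ D ∣D∣≡m →
    let B = only-left x zero D
        ∣B∣≡ = trans (∣only-left∣ x zero D) (cong suc ∣D∣≡m)
    in inj₁ (∣B∣≡ , λ eq → fx≢gx (*-cancelˡ-≡ (f x) (g x) (suc m)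
         (subst (λ b → b * f x ≡ b * g x) ∣B∣≡
           (+-cancelʳ-≡ (wsum g B) (∣ B ∣ * f x) (∣ B ∣ * g x)
             (trans (wsum-shift f g (f x) (g x) balanced B) (cong (∣ B ∣ * g x +_) eq))))))
  go (inj₁ (y , unbalanced)) = count-exchange (differ? f g (suc m)) (λ D → ∣ D ∣ ≟ m) x y exchange
    where
    exchange : ∀ D → ∣ D ∣ ≡ m → _ ⊎ _
    exchange D ∣D∣≡m with wsum f (only-left x y D) ≟ wsum g (only-left x y D)
    ... | no ≢ = inj₁ (trans (∣only-left∣ x y D) (cong suc ∣D∣≡m) , ≢)
    ... | yes ≡ˡ = inj₂ (trans (∣only-right∣ x y D) (cong suc ∣D∣≡m) , λ ≡ʳ →
      -- Equality on the left set and reversed equality on the right set are added; the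
      -- contributions `F` and `G` of `D` then cancel.
      unbalanced (+-cancelʳ-≡ (F + G) _ _ (begin
        (f x + g z) + (F + G)  ≡⟨ r (f x) (g z) F G ⟩
        (f x + F) + (g z + G)  ≡⟨ cong₂ _+_ (trans (sym (wsum-left f x y D)) (trans ≡ˡ (wsum-left g x y D)))
                                           (trans (sym (wsum-right g x y D)) (trans (sym ≡ʳ) (wsum-right f x y D))) ⟩
        (g x + G) + (f z + F)  ≡⟨ sym (r′ (g x) (f z) F G) ⟩
        (g x + f z) + (F + G)  ∎)))
      where
      z = punchIn x y
      F = wsum (f ∘ punchIn x ∘ punchIn y) D
      G = wsum (g ∘ punchIn x ∘ punchIn y) D
      r : ∀ a b c d → (a + b) + (c + d) ≡ (a + c) + (b + d)
      r = solve-∀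
      r′ : ∀ a b c d → (a + b) + (c + d) ≡ (a + d) + (b + c)
      r′ = solve-∀

-- Edge counts after inserting a vertex

nbr : ∀ {n} → Graph n → Fin n → Fin n → ℕ
nbr G v i = 𝟙 (T? (adj G v i))

-- edge? sees a pair only in increasing order, so at most one of the two summands
-- is non-zero.
edge-at : ∀ {n} (G : Graph n) {A} {v i} → v ∈ A → ¬ v ≡ i →
  𝟙 (edge? G A (v , i)) + 𝟙 (edge? G A (i , v)) ≡ 𝟙 (i ∈? A) * nbr G v i
edge-at G {A} {v} {i} v∈A v≢i = trans split (𝟙-× (i ∈? A) (T? (adj G v i)))
  where
  split : 𝟙 (edge? G A (v , i)) + 𝟙 (edge? G A (i , v)) ≡ 𝟙 ((i ∈? A) ×-dec T? (adj G v i))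
  split with Fin.<-cmp v i
  ... | tri≈ _ v≡i _ = contradiction v≡i v≢i
  ... | tri< v<i _ i≮v = trans (cong₂ _+_
          (𝟙-cong (edge? G A (v , i)) ((i ∈? A) ×-dec T? (adj G v i))
            (λ (_ , _ , b , c) → b , c) (λ (b , c) → v<i , v∈A , b , c))
          (𝟙-no (edge? G A (i , v)) (i≮v ∘ proj₁)))
        (+-identityʳ _)
  ... | tri> v≮i _ i<v = cong₂ _+_
          (𝟙-no (edge? G A (v , i)) (v≮i ∘ proj₁))
          (𝟙-cong (edge? G A (i , v)) ((i ∈? A) ×-dec T? (adj G v i))
            (λ (_ , b , _ , c) → b , subst T (adj-sym G i v) c)
            (λ (b , c) → i<v , b , v∈A , subst T (adj-sym G v i) c))

-- The pairs meeting `v` form a row and a column of the double sum. By `edge-at` the two together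
-- give the degree of `v` into `B`, and the remaining entries are the edges within `B`.
e-inside : ∀ {n} (G : Graph (suc n)) v (B : Subset n) →
  e G (insertAt B v inside) ≡ wsum (nbr G v ∘ punchIn v) B + e (delete G v) B
e-inside {n} G v B = begin
  e G A
    ≡⟨ e-sum G A ⟩
  sum (λ i → sum (E i))
    ≡⟨ sum-remove {i = v} (λ i → sum (E i)) ⟩
  sum (E v) + sum (λ i → sum (E (p i)))
    ≡⟨ cong₂ _+_ (trans (sum-remove {i = v} (E v)) (cong (_+ sum (E v ∘ p)) no-loop))
                 (trans (sum-cong-≗ (λ i → sum-remove {i = v} (E (p i)))) (∑-distrib-+ (λ i → E (p i) v) _)) ⟩
  sum (E v ∘ p) + (sum (λ i → E (p i) v) + sum (λ i → sum (E (p i) ∘ p)))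
    ≡⟨ sym (+-assoc (sum (E v ∘ p)) _ _) ⟩
  sum (E v ∘ p) + sum (λ i → E (p i) v) + sum (λ i → sum (E (p i) ∘ p))
    ≡⟨ cong₂ _+_ (trans (sym (∑-distrib-+ (E v ∘ p) _)) (sum-cong-≗ at-v)) rest ⟩
  wsum (nbr G v ∘ p) B + e (delete G v) B ∎
  where
  open ≡-Reasoning
  p = punchIn v
  A = insertAt B v inside
  E : Fin (suc n) → Fin (suc n) → ℕ
  E i j = 𝟙 (edge? G A (i , j))

  no-loop : E v v ≡ 0
  no-loop = 𝟙-no (edge? G A (v , v)) (Fin.<-irrefl refl ∘ proj₁)

  at-v : ∀ i → E v (p i) + E (p i) v ≡ 𝟙 (i ∈? B) * nbr G v (p i)
  at-v i = trans (edge-at G (v∈insertAt v B) (Fin.punchInᵢ≢i v i ∘ sym))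
    (cong (_* nbr G v (p i)) (𝟙-cong (p i ∈? A) (i ∈? B) (∈-insertAt⁻ v) (∈-insertAt⁺ v)))

  rest : sum (λ i → sum (E (p i) ∘ p)) ≡ e (delete G v) B
  rest = trans (sum-cong-≗ (λ i → sum-cong-≗ (λ j →
      𝟙-cong (edge? G A (p i , p j)) (edge? (delete G v) B (i , j))
        (λ (a , b , c , d) → punchIn-cancel-< v a , ∈-insertAt⁻ v b , ∈-insertAt⁻ v c , d)
        (λ (a , b , c , d) → punchIn-mono-< v a , ∈-insertAt⁺ v b , ∈-insertAt⁺ v c , d))))
    (sym (e-sum (delete G v) B))

e-outside : ∀ {n} (G : Graph (suc n)) v (B : Subset n) → e G (insertAt B v outside) ≡ e (delete G v) B
e-outside G v = e-without G (delete G v) v (λ _ _ → refl)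

-- The last summand recurs in `e-right`, so the two exchanged sets span equally many edges only if
-- both exchanged vertices have the same degree into `D`.
e-left : ∀ {n} (G : Graph (suc (suc n))) u w (D : Subset n) →
  e G (only-left u w D) ≡ wsum (nbr G u ∘ punchIn u ∘ punchIn w) D + e (delete (delete G u) w) D
e-left G u w D = trans (e-inside G u _)
  (cong₂ _+_ (wsum-outside (nbr G u ∘ punchIn u) w D) (e-outside (delete G u) w D))

e-right : ∀ {n} (G : Graph (suc (suc n))) u w (D : Subset n) →
  e G (only-right u w D) ≡ wsum (nbr G (punchIn u w) ∘ punchIn u ∘ punchIn w) D + e (delete (delete G u) w) D
e-right G u w D = trans (e-outside G u _) (e-inside (delete G u) w D)

-- Sets that do not span ℓ edges

miss? : ∀ {n} (G : Graph n) k ℓ (A : Subset n) → Dec (∣ A ∣ ≡ k × ¬ e G A ≡ ℓ)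
miss? G k ℓ A = (∣ A ∣ ≟ k) ×-dec ¬? (e G A ≟ ℓ)

good+miss : ∀ {n} (G : Graph n) k ℓ → good G k ℓ + count (miss? G k ℓ) ≡ #kSubsets n k
good+miss {n} G k ℓ = begin
  good G k ℓ + count (miss? G k ℓ)
    ≡⟨ cong (_+ count (miss? G k ℓ)) (good-sum G k ℓ) ⟩
  sumˢ (weight k (hit G ℓ)) + count (miss? G k ℓ)
    ≡⟨ sym (sumˢ-+ (weight k (hit G ℓ)) (λ A → 𝟙 (miss? G k ℓ A))) ⟩
  sumˢ (λ A → weight k (hit G ℓ) A + 𝟙 (miss? G k ℓ A))
    ≡⟨ sumˢ-cong (λ A → split (∣ A ∣ ≟ k) (e G A ≟ ℓ)) ⟩
  sumˢ {n} (λ A → 𝟙 (∣ A ∣ ≟ k))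
    ≡⟨ sym (#kSubsets-sum n k) ⟩
  #kSubsets n k ∎
  where
  open ≡-Reasoning
  split : ∀ {P Q : Set} (p : Dec P) (q : Dec Q) → 𝟙 p * 𝟙 q + 𝟙 (p ×-dec ¬? q) ≡ 𝟙 p
  split (yes _) (yes _) = refl
  split (yes _) (no _)  = refl
  split (no _)  _       = refl

-- Two nested exchanges, each using up two vertices and adding one to the size. The inner one starts
-- at the distinguishing vertex `z` and yields (k+1)-sets on which the degrees of `u` and
-- `punchIn u w` differ; the outer one exchanges these two vertices.
count-miss : ∀ {n} (G : Graph (suc (suc (suc (suc n))))) k ℓ u w z →
  ¬ adj G u (punchIn u (punchIn w z)) ≡ adj G (punchIn u w) (punchIn u (punchIn w z)) →
  #kSubsets n k ≤ count (miss? G (suc (suc k)) ℓ)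
count-miss {n} G k ℓ u w z ≢ = ≤-trans (count-differ f g k z (≢ ∘ 𝟙T-injective))
  (count-exchange (miss? G (suc (suc k)) ℓ) (differ? f g (suc k)) u w exchange)
  where
  f g : Fin (suc (suc n)) → ℕ
  f = nbr G u ∘ punchIn u ∘ punchIn w
  g = nbr G (punchIn u w) ∘ punchIn u ∘ punchIn w

  𝟙T-injective : ∀ {b c} → 𝟙 (T? b) ≡ 𝟙 (T? c) → b ≡ c
  𝟙T-injective {true}  {true}  _ = refl
  𝟙T-injective {false} {false} _ = refl

  exchange : ∀ D → ∣ D ∣ ≡ suc k × ¬ wsum f D ≡ wsum g D → _ ⊎ _
  exchange D (∣D∣≡ , wf≢wg) with e G (only-left u w D) ≟ ℓ
  ... | no ≢ℓ = inj₁ (trans (∣only-left∣ u w D) (cong suc ∣D∣≡) , ≢ℓ)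
  ... | yes ≡ℓ = inj₂ (trans (∣only-right∣ u w D) (cong suc ∣D∣≡) , λ ≡ℓ′ →
    wf≢wg (+-cancelʳ-≡ (e (delete (delete G u) w) D) _ _
      (trans (sym (e-left G u w D)) (trans (trans ≡ℓ (sym ≡ℓ′)) (e-right G u w D)))))

-- Twins, and graphs that are complete (`true`) or empty (`false`)

Homogeneous : ∀ {n} → Graph n → Bool → Set
Homogeneous G b = ∀ i j → ¬ i ≡ j → adj G i j ≡ b

-- Induction on the vertices: a new vertex of the set is joined to all or none of the others, and
-- Pascal's rule absorbs the added edges.
e-homogeneous : ∀ {n} (G : Graph n) b → Homogeneous G b → ∀ A → e G A ≡ (∣ A ∣ C 2) * 𝟙 (T? b)
e-homogeneous G b h [] = refl
e-homogeneous G b h (outside ∷ A) = trans (e-outside G zero A)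
  (e-homogeneous (delete G zero) b (λ i j i≢j → h (suc i) (suc j) (i≢j ∘ Fin.suc-injective)) A)
e-homogeneous G b h (inside ∷ A) = begin
  e G (inside ∷ A)
    ≡⟨ e-inside G zero A ⟩
  wsum (nbr G zero ∘ suc) A + e (delete G zero) A
    ≡⟨ cong₂ _+_ (wsum-const A (λ i → cong (λ c → 𝟙 (T? c)) (h zero (suc i) λ ())))
         (e-homogeneous (delete G zero) b (λ i j i≢j → h (suc i) (suc j) (i≢j ∘ Fin.suc-injective)) A) ⟩
  ∣ A ∣ * 𝟙 (T? b) + (∣ A ∣ C 2) * 𝟙 (T? b)
    ≡⟨ sym (*-distribʳ-+ (𝟙 (T? b)) ∣ A ∣ (∣ A ∣ C 2)) ⟩
  (∣ A ∣ + ∣ A ∣ C 2) * 𝟙 (T? b)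
    ≡⟨ cong (_* 𝟙 (T? b)) (trans (cong (_+ ∣ A ∣ C 2) (sym (nC1≡n ∣ A ∣))) (nCk+nC[k+1]≡[n+1]C[k+1] ∣ A ∣ 1)) ⟩
  (suc ∣ A ∣ C 2) * 𝟙 (T? b) ∎
  where
  open ≡-Reasoning
  wsum-const : ∀ {n} {f : Fin n → ℕ} {c} (A : Subset n) → (∀ i → f i ≡ c) → wsum f A ≡ ∣ A ∣ * c
  wsum-const {f = f} {c} A f≡c = +-cancelˡ-≡ (∣ A ∣ * 0) _ _ (trans
    (wsum-shift (λ _ → 0) f 0 c (λ i → trans (f≡c i) (sym (+-identityʳ c))) A)
    (trans (cong (∣ A ∣ * c +_) (wsum-zero A)) (+-comm (∣ A ∣ * c) _)))
    where
    wsum-zero : ∀ {n} (A : Subset n) → wsum (λ _ → 0) A ≡ ∣ A ∣ * 0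
    wsum-zero A = trans (sum-zero (λ i → *-zeroʳ (𝟙 (i ∈? A)))) (sym (*-zeroʳ ∣ A ∣))

-- Excluding `i` and `j` leaves open whether twins are adjacent to each other.
Twins : ∀ {n} → Graph n → Fin n → Fin n → Set
Twins G i j = ∀ l → ¬ l ≡ i → ¬ l ≡ j → adj G i l ≡ adj G j l

-- Replacing one endpoint at a time by a twin moves any pair to {0, j} and then to {0, 1} without
-- changing its adjacency.
twins⇒homogeneous : ∀ {n} (G : Graph (suc (suc n))) → (∀ i j → Twins G i j) →
  Homogeneous G (adj G zero (suc zero))
twins⇒homogeneous {n} G twins = go
  where
  from-zero : ∀ j → ¬ zero ≡ j → adj G zero j ≡ adj G zero (suc zero)
  from-zero j 0≢j with j Fin.≟ suc zero
  ... | yes refl = refl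
  ... | no j≢1 = trans (adj-sym G zero j)
    (trans (twins j (suc zero) zero 0≢j λ ()) (adj-sym G (suc zero) zero))

  go : Homogeneous G (adj G zero (suc zero))
  go zero    j       i≢j = from-zero j i≢j
  go (suc i) zero    i≢j = trans (adj-sym G (suc i) zero) (from-zero (suc i) λ ())
  go (suc i) (suc j) i≢j = trans (twins (suc i) zero (suc j) (i≢j ∘ sym) λ ()) (from-zero (suc j) λ ())

-- Nested `punchIn` parametrises the triples of distinct vertices, so a finite search decides
-- between the alternatives and returns the form `count-miss` takes.
∃-non-twins : ∀ {n} (G : Graph (suc (suc n))) →
  (∃[ u ] ∃[ w ] ∃[ z ] ¬ adj G u (punchIn u (punchIn w z)) ≡ adj G (punchIn u w) (punchIn u (punchIn w z)))
  ⊎ (∀ i j → Twins G i j)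
∃-non-twins {n} G with Fin.any? (λ u → Fin.any? (λ w → Fin.any? (λ z →
  ¬? (adj G u (punchIn u (punchIn w z)) Bool.≟ adj G (punchIn u w) (punchIn u (punchIn w z))))))
... | yes found = inj₁ found
... | no none = inj₂ twins
  where
  twins : ∀ i j → Twins G i j
  twins i j l l≢i l≢j with i Fin.≟ j
  ... | yes refl = refl
  ... | no i≢j with adj G i l Bool.≟ adj G j l
  ...   | yes eq = eq
  ...   | no ≢ = contradiction (i , punchOut i≢j , punchOut w≢l , λ eq → ≢
            (trans (cong (adj G i) (sym l≡)) (trans eq (cong₂ (adj G) (Fin.punchIn-punchOut i≢j) l≡)))) none
    where
    w≢l : ¬ punchOut i≢j ≡ punchOut (l≢i ∘ sym)
    w≢l eq = l≢j (sym (Fin.punchOut-injective i≢j (l≢i ∘ sym) eq))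
    l≡ : punchIn i (punchIn (punchOut i≢j) (punchOut w≢l)) ≡ l
    l≡ = trans (cong (punchIn i) (Fin.punchIn-punchOut w≢l)) (Fin.punchIn-punchOut (l≢i ∘ sym))

-- Growth of central binomial coefficients

#kSubsets-pascal : ∀ n k → #kSubsets (suc n) (suc k) ≡ #kSubsets n k + #kSubsets n (suc k)
#kSubsets-pascal n k = trans (#kSubsets-sum (suc n) (suc k)) (cong₂ _+_
  (trans (sumˢ-cong {n} (λ A → 𝟙-cong (suc ∣ A ∣ ≟ suc k) (∣ A ∣ ≟ k) suc-injective (cong suc)))
         (sym (#kSubsets-sum n k)))
  (sym (#kSubsets-sum n (suc k))))

-- C(2m+2, m+1) = 2 C(2m+1, m), and (m+1) C(2m+1, m) = (2m+1) C(2m, m) bounds the latter by twice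
-- C(2m, m).
#kSubsets-central : ∀ m → #kSubsets (suc (suc (m + m))) (suc m) ≤ 4 * #kSubsets (m + m) m
#kSubsets-central m = begin
  K₂                ≡⟨ sym 2K₁≡K₂ ⟩
  2 * K₁            ≤⟨ *-monoʳ-≤ 2 K₁≤2K₀ ⟩
  2 * (2 * K₀)      ≡⟨ sym (*-assoc 2 2 K₀) ⟩
  4 * K₀            ∎
  where
  open ≤-Reasoning
  K₀ = #kSubsets (m + m) m
  K₁ = #kSubsets (suc (m + m)) (suc m)
  K₁′ = #kSubsets (suc (m + m)) m
  K₂ = #kSubsets (suc (suc (m + m))) (suc m)

  2K₁≡K₂ : 2 * K₁ ≡ K₂
  2K₁≡K₂ = *-cancelˡ-≡ (2 * K₁) K₂ (suc m) (+-cancelʳ-≡ (suc m * K₂) _ _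
    (trans (r₁ m K₁ K₂) (trans (#kSubsets-suc (suc (m + m)) (suc m)) (r₂ m K₂))))
    where
    r₁ : ∀ m x y → suc m * (2 * x) + suc m * y ≡ suc (suc (m + m)) * x + suc m * y
    r₁ = solve-∀
    r₂ : ∀ m y → suc (suc (m + m)) * y ≡ suc m * y + suc m * y
    r₂ = solve-∀

  K₁′≡K₁ : K₁′ ≡ K₁
  -- Symmetry of the binomial coefficient without complements: `K₁′ + K₁` is `K₂` by Pascal's rule,
  -- and `K₂` is `2 * K₁`.
  K₁′≡K₁ = +-cancelʳ-≡ K₁ K₁′ K₁
    (trans (sym (#kSubsets-pascal (suc (m + m)) m)) (trans (sym 2K₁≡K₂) (cong (K₁ +_) (+-identityʳ K₁))))

  K₁≤2K₀ : K₁ ≤ 2 * K₀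
  K₁≤2K₀ = subst (_≤ 2 * K₀) K₁′≡K₁ (*-cancelˡ-≤ (suc m) (+-cancelʳ-≤ (m * K₁′) _ _ (begin
    suc m * K₁′ + m * K₁′            ≡⟨ r₁ m K₁′ ⟩
    suc (m + m) * K₁′                ≡⟨ sym (#kSubsets-suc (m + m) m) ⟩
    -- The added `K₀` rounds the factor 2m+1 up to 2(m+1).
    suc (m + m) * K₀ + m * K₁′       ≤⟨ +-monoˡ-≤ (m * K₁′) (m≤m+n _ K₀) ⟩
    suc (m + m) * K₀ + K₀ + m * K₁′  ≡⟨ cong (_+ m * K₁′) (r₂ m K₀) ⟩
    suc m * (2 * K₀) + m * K₁′       ∎)))
    where
    r₁ : ∀ m x → suc m * x + m * x ≡ suc (m + m) * x
    r₁ = solve-∀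
    r₂ : ∀ m x → suc (m + m) * x + x ≡ suc m * (2 * x)
    r₂ = solve-∀

#kSubsets-central² : ∀ m →
  #kSubsets (suc (suc (suc (suc (m + m))))) (suc (suc m)) ≤ 16 * #kSubsets (m + m) m
#kSubsets-central² m = begin
  #kSubsets (suc (suc (suc (suc (m + m))))) (suc (suc m))
    ≡⟨ cong (λ n → #kSubsets (suc (suc (suc n))) (suc (suc m))) (sym (+-suc m m)) ⟩
  #kSubsets (suc (suc (suc m + suc m))) (suc (suc m))
    ≤⟨ #kSubsets-central (suc m) ⟩
  4 * #kSubsets (suc m + suc m) (suc m)
    ≡⟨ cong (λ n → 4 * #kSubsets (suc n) (suc m)) (+-suc m m) ⟩
  4 * #kSubsets (suc (suc (m + m))) (suc m)
    ≤⟨ *-monoʳ-≤ 4 (#kSubsets-central m) ⟩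
  4 * (4 * #kSubsets (m + m) m)
    ≡⟨ sym (*-assoc 4 4 (#kSubsets (m + m) m)) ⟩
  16 * #kSubsets (m + m) m ∎
  where open ≤-Reasoning

-- The bound for graphs on 2k vertices and its transfer to the limit

good-homogeneous : ∀ {n} (G : Graph n) b → Homogeneous G b → ∀ k ℓ → 0 < ℓ → ℓ < k C 2 → good G k ℓ ≡ 0
good-homogeneous {n} G b h k ℓ 0<ℓ ℓ<kC2 = trans (good-sum G k ℓ)
  (trans (sumˢ-cong zero-weight) (sumˢ-* 0 (λ (_ : Subset n) → 0)))
  where
  ℓ-extreme : ∀ b → ¬ (k C 2) * 𝟙 (T? b) ≡ ℓ
  ℓ-extreme true  eq = <-irrefl (trans (sym eq) (*-identityʳ (k C 2))) ℓ<kC2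
  ℓ-extreme false eq = <-irrefl (trans (sym (*-zeroʳ (k C 2))) eq) 0<ℓ

  zero-weight : ∀ A → weight k (hit G ℓ) A ≡ 0
  zero-weight A = trans (sym (𝟙-× (∣ A ∣ ≟ k) (e G A ≟ ℓ)))
    (𝟙-no ((∣ A ∣ ≟ k) ×-dec (e G A ≟ ℓ)) λ { (refl , eq) → ℓ-extreme b (trans (sym (e-homogeneous G b h A)) eq) })

-- Here k = m + 2 and `G` has 2k vertices. Without non-twins there are no hits; otherwise C(2m, m)
-- misses make up at least 1/16 of all k-sets.
good-bound : ∀ m ℓ → 0 < ℓ → ℓ < suc (suc m) C 2 → (G : Graph (suc (suc (suc (suc (m + m)))))) →
  good G (suc (suc m)) ℓ * 16 ≤ 15 * #kSubsets (suc (suc (suc (suc (m + m))))) (suc (suc m))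
good-bound m ℓ 0<ℓ ℓ< G with ∃-non-twins G
... | inj₂ twins = subst (λ g → g * 16 ≤ 15 * #kSubsets (suc (suc (suc (suc (m + m))))) (suc (suc m)))
        (sym (good-homogeneous G _ (twins⇒homogeneous G twins) (suc (suc m)) ℓ 0<ℓ ℓ<)) z≤n
... | inj₁ (u , w , z , ≢) = +-cancelʳ-≤ K (g * 16) (15 * K) (begin
  g * 16 + K                    ≤⟨ +-monoʳ-≤ (g * 16) (#kSubsets-central² m) ⟩
  g * 16 + 16 * #kSubsets (m + m) m
                                ≤⟨ +-monoʳ-≤ (g * 16) (*-monoʳ-≤ 16 (count-miss G m ℓ u w z ≢)) ⟩
  g * 16 + 16 * count (miss? G (suc (suc m)) ℓ)
                                ≡⟨ r g (count (miss? G (suc (suc m)) ℓ)) ⟩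
  15 * (g + count (miss? G (suc (suc m)) ℓ)) + (g + count (miss? G (suc (suc m)) ℓ))
                                ≡⟨ cong (λ K → 15 * K + K) (good+miss G (suc (suc m)) ℓ) ⟩
  15 * K + K                    ∎)
  where
  open ≤-Reasoning
  g = good G (suc (suc m)) ℓ
  K = #kSubsets (suc (suc (suc (suc (m + m))))) (suc (suc m))
  r : ∀ g b → g * 16 + 16 * b ≡ 15 * (g + b) + (g + b)
  r = solve-∀

-- Induction on the excess `t` of `n` over 2k, by monotonicity. The equation for `n` lets the bound
-- apply to the index of `I-seq`, which has another form.
I-bound : ∀ m ℓ → 0 < ℓ → ℓ < suc (suc m) C 2 → ∀ t n .(p : suc (suc m) ≤ n) →
  n ≡ t + suc (suc (suc (suc (m + m)))) → I n (suc (suc m)) ℓ p ℚ.≤ ℤ.+ 15 ℚ./ 16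
I-bound m ℓ 0<ℓ ℓ< zero n p refl = subst (ℚ._≤ ℤ.+ 15 ℚ./ 16) (sym (proj₂ attained))
  (fraction-≤ (good G k ℓ) (#kSubsets n k) 15 16 {{#kSubsets-pos p}} (good-bound m ℓ 0<ℓ ℓ< G))
  where
  k = suc (suc m)
  attained = I-attained {n} k ℓ p
  G = proj₁ attained
I-bound m ℓ 0<ℓ ℓ< (suc t) (suc n) p refl = ℚ.≤-trans (I-decreasing n (suc (suc m)) ℓ p′ p)
  (I-bound m ℓ 0<ℓ ℓ< t n p′ refl)
  where
  p′ : suc (suc m) ≤ n
  p′ = ≤-trans (s≤s (s≤s (≤-trans (m≤m+n m m) (≤-trans (n≤1+n _) (n≤1+n _))))) (m≤n+m _ t)

theorem1p3 : ∃[ ε ] (0ℝ <ℝ ε × (∀ (k ℓ : ℕ) → 0 < k → 0 < ℓ → ℓ < k C 2 → ind k ℓ <ℝ 1ℝ -ℝ ε))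
theorem1p3 = fromℚ δ , (δ , 0<δ , 0 , λ _ _ → ℚ.≤-refl) , bound
  where
  -- Half of 1/16: one 1/32 is ε, the other is the gap that `_<ℝ_` demands, as 15/16 + 1/32 = 1 -
  -- 1/32.
  δ = ℤ.+ 1 ℚ./ 32

  0<δ : 0ℚ ℚ.< δ
  0<δ = ℚ.positive⁻¹ δ

  bound : ∀ k ℓ → 0 < k → 0 < ℓ → ℓ < k C 2 → ind k ℓ <ℝ 1ℝ -ℝ fromℚ δ
  bound 1 ℓ _ _ ()
  -- The n-th term of `I-seq` concerns graphs on n + k vertices, so n ≥ k ensures at least 2k of
  -- them.
  bound (suc (suc m)) ℓ _ 0<ℓ ℓ< = δ , 0<δ , suc (suc m) , λ n N≤n →
    ℚ.+-monoˡ-≤ δ (I-bound m ℓ 0<ℓ ℓ< (n ∸ suc (suc m)) (n + suc (suc m)) (m≤n+m _ n) (begin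
      n + suc (suc m)
        ≡⟨ cong (_+ suc (suc m)) (sym (m∸n+n≡m N≤n)) ⟩
      n ∸ suc (suc m) + suc (suc m) + suc (suc m)
        ≡⟨ r (n ∸ suc (suc m)) m ⟩
      n ∸ suc (suc m) + suc (suc (suc (suc (m + m)))) ∎))
    where
    open ≡-Reasoning
    r : ∀ t m → t + suc (suc m) + suc (suc m) ≡ t + suc (suc (suc (suc (m + m))))
    r = solve-∀
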